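{- Let $I\subseteq\mathbb{R}$ be an open interval and let $f$ be a non-constant real analytic function on $I$ with $f(\mathbb{Q}\cap I)\subseteq\mathbb{Q}$. Assume that there exists a function $\psi:\mathbb{R}_{>0}\to\mathbb{R}_{>0}$ with the following properties: (i) $\psi(m)=o(m)$ as $m\to\infty$; (ii) for every $\zeta\in\mathscr{L}\cap I$ and every integer $m\geq 1$ one can find coprime integers $p_m,q_m\geq 2$ such that $\left|\zeta-\frac{p_m}{q_m}\right|\leq q_m^{ -m}$ and, writing $f(p_m/q_m)=p_m'/q_m'$ in lowest terms, one has $q_m'\leq q_m^{\psi(m)}$. Then $f(\mathscr{L}\cap I)\subseteq\mathscr{L}$.
   Context: $\mathscr{L}$ denotes the set of Liouville numbers: real irrational numbers $\zeta$ such that for every $\eta>0$ the inequality $|\zeta-y/x|\leq x^{ -\eta}$ has infinitely many rational solutions $y/x$ with $x\geq 1$ (equivalently, real numbers with infinite irrationality exponent). For a set $A$, $f(A)=\{f(x):x\in A\}$. -}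

module Defs where

open import Level using (0ℓ; suc)
open import Algebra.Bundles using (CommutativeRing)
open import Data.Product using (Σ; ∃; _×_; _,_; proj₁)
open import Data.Sum using (inj₁; inj₂)
open import Data.Fin using (toℕ)
open import Data.Nat.Base as ℕ using (ℕ)
open import Data.Integer.Base as ℤ using (ℤ; +_; -[1+_])
open import Data.Rational.Base using (ℚ; ↥_; ↧ₙ_)
open import Data.List.Base using (List)
open import Data.List.Membership.Propositional using (_∉_)
open import Function.Bundles using (Func)
open import Relation.Nullary using (¬_)
open import Relation.Nullary.Construct.Add.Extrema using (_±; [_])
open import Relation.Unary using (Pred; Satisfiable)
open import Relation.Binary using (Rel; Setoid; IsTotalOrder; TotalOrder)
import Relation.Binary.Construct.On as On
import Relation.Binary.Construct.NonStrictToStrict as ToStrict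
import Relation.Binary.Construct.Add.Extrema.Strict as Extended
import Algebra.Construct.NaturalChoice.Max as Max
import Algebra.Properties.Ring as RingProperties
import Algebra.Properties.Semiring.Exp as Exp
import Algebra.Properties.Semiring.Mult as Mult
import Algebra.Properties.Semiring.Sum as Sum

module _ {A : Set} (_≤_ : Rel A 0ℓ) where

  UpperBound : Pred A 0ℓ → Pred A 0ℓ
  UpperBound S u = ∀ s → S s → s ≤ u

  IsSupremum : Pred A 0ℓ → Pred A 0ℓ
  IsSupremum S u = UpperBound S u × (∀ v → UpperBound S v → u ≤ v)

-- The real numbers, characterised (uniquely up to isomorphism, classically) as
-- a Dedekind-complete ordered field.  `_⁻¹` and `sup` are total: no axiom says
-- what 0# ⁻¹ is, nor what sup S is when S is empty or unbounded above.
record CompleteOrderedField : Set (suc 0ℓ) where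
  field
    commutativeRing : CommutativeRing 0ℓ 0ℓ

  open CommutativeRing commutativeRing public

  infix  4 _≤_
  infix  8 _⁻¹
  field
    _≤_          : Rel Carrier 0ℓ
    isTotalOrder : IsTotalOrder _≈_ _≤_
    +-monoˡ-≤    : ∀ z {x y} → x ≤ y → x + z ≤ y + z
    *-nonneg     : ∀ {x y} → 0# ≤ x → 0# ≤ y → 0# ≤ x * y
    1≉0          : ¬ (1# ≈ 0#)
    _⁻¹          : Carrier → Carrier
    ⁻¹-cong      : ∀ {x y} → x ≈ y → x ⁻¹ ≈ y ⁻¹
    ⁻¹-inverseʳ  : ∀ {x} → ¬ (x ≈ 0#) → x * x ⁻¹ ≈ 1#
    sup          : Pred Carrier 0ℓ → Carrier
    isSupremum   : ∀ S → Satisfiable S → Satisfiable (UpperBound _≤_ S) →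
                   IsSupremum _≤_ S (sup S)

  totalOrder : TotalOrder 0ℓ 0ℓ 0ℓ
  totalOrder = record { isTotalOrder = isTotalOrder }

module Reals (ℝ : CompleteOrderedField) where

  open CompleteOrderedField ℝ public
  open IsTotalOrder isTotalOrder public
    using (total; antisym; ≤-respˡ-≈; ≤-respʳ-≈)
    renaming (refl to ≤-refl; reflexive to ≤-reflexive; trans to ≤-trans)
  open ToStrict _≈_ _≤_ public using (_<_)
  open Extended _<_ public using (_<±_)
  open Max totalOrder public using (_⊔_)
  open Exp semiring public using (_^_)
  open Mult semiring public using () renaming (_×_ to _·_)
  open Sum semiring public using (sum)

  ∣_∣ : Carrier → Carrier
  ∣ x ∣ = x ⊔ - x

  fromℕ : ℕ → Carrier
  fromℕ n = n · 1#

  fromℤ : ℤ → Carrier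
  fromℤ (+ n)      = fromℕ n
  fromℤ (-[1+ n ]) = - fromℕ (ℕ.suc n)

  fromℚ : ℚ → Carrier
  fromℚ r = fromℤ (↥ r) * fromℕ (↧ₙ r) ⁻¹

  Subsetoid : Pred Carrier 0ℓ → Setoid 0ℓ 0ℓ
  Subsetoid P = On.setoid {B = Σ Carrier P} setoid proj₁

  ℝ⁺ : Setoid 0ℓ 0ℓ
  ℝ⁺ = Subsetoid (0# <_)

  0≤1 : 0# ≤ 1#
  0≤1 with total 0# 1#
  ... | inj₁ 0≤1 = 0≤1
  ... | inj₂ 1≤0 = ≤-respʳ-≈ -1*-1≈1 (*-nonneg 0≤-1 0≤-1)
    where
    open RingProperties ring using (-‿distribˡ-*; -‿involutive)
    0≤-1 : 0# ≤ - 1#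
    0≤-1 = ≤-respˡ-≈ (-‿inverseʳ 1#)
             (≤-respʳ-≈ (+-identityˡ (- 1#)) (+-monoˡ-≤ (- 1#) 1≤0))
    -1*-1≈1 : - 1# * - 1# ≈ 1#
    -1*-1≈1 = trans (sym (-‿distribˡ-* 1# (- 1#)))
                (trans (-‿cong (*-identityˡ (- 1#))) (-‿involutive 1#))

  fromℕ-≤-suc : ∀ n → fromℕ n ≤ fromℕ (ℕ.suc n)
  fromℕ-≤-suc n = ≤-respˡ-≈ (+-identityˡ (fromℕ n)) (+-monoˡ-≤ (fromℕ n) 0≤1)

  1≤fromℕ-suc : ∀ n → 1# ≤ fromℕ (ℕ.suc n)
  1≤fromℕ-suc ℕ.zero    = ≤-reflexive (sym (+-identityʳ 1#))
  1≤fromℕ-suc (ℕ.suc n) = ≤-trans (1≤fromℕ-suc n) (fromℕ-≤-suc (ℕ.suc n))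

  0<fromℕ-suc : ∀ n → 0# < fromℕ (ℕ.suc n)
  0<fromℕ-suc n = ≤-trans 0≤1 (1≤fromℕ-suc n) ,
    λ 0≈1+n → 1≉0 (antisym (≤-respʳ-≈ (sym 0≈1+n) (1≤fromℕ-suc n)) 0≤1)

  fromℕ⁺ : (n : ℕ) .{{_ : ℕ.NonZero n}} → Setoid.Carrier ℝ⁺
  fromℕ⁺ (ℕ.suc n) = fromℕ (ℕ.suc n) , 0<fromℕ-suc n

  -- b ^ t = sup { b ^ (k / l) | k / l ≤ t }, where z = b ^ (k / l) is encoded as
  -- the nonnegative solution of z ^ l = b ^ k.  This is the usual real power
  -- for b ≥ 1, the only bases it is used with.
  infixr 8 _^ᴿ_
  _^ᴿ_ : Carrier → Setoid.Carrier ℝ⁺ → Carrier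
  b ^ᴿ (t , _) = sup λ z → 0# ≤ z ×
    ∃ λ (k : ℕ) → ∃ λ (l : ℕ) →
      ℕ.NonZero l × fromℕ k ≤ fromℕ l * t × z ^ l ≈ b ^ k

  _⟶_ : (ℕ → Carrier) → Carrier → Set
  s ⟶ x = ∀ ε → 0# < ε → ∃ λ N → ∀ n → N ℕ.≤ n → ∣ s n - x ∣ < ε

  -- The endpoints may be infinite.
  OpenInterval : Carrier ± → Carrier ± → Pred Carrier 0ℓ
  OpenInterval a b x = (a <± [ x ]) × ([ x ] <± b)

  module _ {D : Pred Carrier 0ℓ} (f : Func (Subsetoid D) setoid) where

    open Func f using (to)

    RealAnalytic : Set
    RealAnalytic = ∀ x₀ → D x₀ →
      ∃ λ (c : ℕ → Carrier) → ∃ λ ρ → 0# < ρ ×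
        (∀ x (x∈D : D x) → ∣ x - x₀ ∣ < ρ →
          (λ n → sum {n} (λ i → c (toℕ i) * (x - x₀) ^ toℕ i)) ⟶ to (x , x∈D))

    Constant : Set
    Constant = ∃ λ c → ∀ x (x∈D : D x) → to (x , x∈D) ≈ c

    PreservesRationals : Set
    PreservesRationals = ∀ r (r∈D : D (fromℚ r)) →
      ∃ λ r′ → to (fromℚ r , r∈D) ≈ fromℚ r′

  Irrational : Pred Carrier 0ℓ
  Irrational x = ¬ (∃ λ r → x ≈ fromℚ r)

  Infinite : Pred ℚ 0ℓ → Set
  Infinite P = ∀ (rs : List ℚ) → ∃ λ r → r ∉ rs × P r

  -- A solution is a rational number y / x in lowest terms.  Allowing
  -- unreduced fractions would give the same set of rational numbers, since
  -- x ^ (- η) decreases in x.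
  Liouville : Pred Carrier 0ℓ
  Liouville ζ = Irrational ζ ×
    (∀ η → Infinite λ r → ∣ ζ - fromℚ r ∣ ≤ (fromℕ (↧ₙ r) ^ᴿ η) ⁻¹)

  -- ψ(m) = o(m) as m → ∞
  Sublinear : Func ℝ⁺ ℝ⁺ → Set
  Sublinear ψ = ∀ ε → 0# < ε → ∃ λ M → ∀ m → M < proj₁ m →
    proj₁ (Func.to ψ m) ≤ ε * proj₁ m

  -- The rationals r = p_m / q_m and r′ = p_m′ / q_m′ are in lowest terms because
  -- the numerator and denominator of every element of ℚ are coprime.
  GoodApproximations : ∀ {D} → Func (Subsetoid D) setoid → Func ℝ⁺ ℝ⁺ → Set
  GoodApproximations {D} f ψ =
    ∀ ζ → Liouville ζ → D ζ → ∀ (m : ℕ) .{{_ : ℕ.NonZero m}} →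
    ∃ λ (r : ℚ) → (+ 2 ℤ.≤ ↥ r) × (2 ℕ.≤ ↧ₙ r) ×
      (∣ ζ - fromℚ r ∣ ≤ (fromℕ (↧ₙ r) ^ m) ⁻¹) ×
      (∃ λ (r∈D : D (fromℚ r)) → ∃ λ (r′ : ℚ) →
        (Func.to f (fromℚ r , r∈D) ≈ fromℚ r′) ×
        (fromℕ (↧ₙ r′) ≤ fromℕ (↧ₙ r) ^ᴿ Func.to ψ (fromℕ⁺ m)))

{-# OPTIONS --safe #-}

-- With m = j (n + 1) in hypothesis (ii) and j large, ψ(m) ≤ j, so r = p_m / q_m
-- and X = q_m ^ j satisfy |ζ - r| ≤ X ^ -(n + 1), while f(r) is a rational with
-- denominator q′ ≤ X.  As f is Lipschitz at ζ, |f(ζ) - f(r)| q′ ^ n = O(1 / X),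
-- which is the Liouville property for f(ζ) provided f(ζ) is irrational.
--
-- If f(ζ) were rational, the case n = 1 would force f(r) = f(ζ), because distinct
-- rationals with denominators q and q′ differ by at least 1 / (q q′).  The points
-- r ≠ ζ accumulate at ζ, so by the identity theorem f would be constant.

module Submission where

open import Defs
open import Level using (0ℓ)
open import Axiom.ExcludedMiddle using (ExcludedMiddle)
open import Data.Product using (∃; _×_; _,_; proj₁; proj₂)
open import Function.Bundles using (Func)
open import Relation.Nullary using (¬_; yes; no)

open import Algebra.Bundles using (RawRing)
open import Algebra.Solver.Ring.AlmostCommutativeRing using (fromCommutativeRing; _-Raw-AlmostCommutative⟶_)
open import Data.Empty using (⊥-elim)
open import Data.Fin.Base using (toℕ)
open import Data.Integer.Base as ℤ using (ℤ; +_; -[1+_]; _⊖_)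
open import Data.List.Base using ([]; _∷_)
open import Data.List.Membership.Propositional using (_∈_; _∉_)
open import Data.List.Relation.Unary.Any using (here; there)
open import Data.Maybe.Base using (Maybe; just; nothing)
open import Data.Nat.Base as ℕ using (ℕ; zero; suc; z≤n; s≤s)
open import Data.Rational.Base using (ℚ; module ℚ; ↥_; ↧ₙ_; ↧_)
open import Data.Sum using (_⊎_; inj₁; inj₂)
open import Function.Base using (_∘_)
open import Relation.Binary using (Setoid; TotalOrder)
open import Relation.Binary.PropositionalEquality as ≡ using (_≡_)
open import Relation.Nullary.Construct.Add.Extrema using ([_])
open import Relation.Unary using (Pred)
import Algebra.Construct.NaturalChoice.Max as Max
import Algebra.Properties.CommutativeSemigroup as CommutativeSemigroupProperties
import Algebra.Properties.CommutativeSemiring.Exp as CommutativeExp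
import Algebra.Properties.Monoid.Mult.TCOptimised as OptimisedMult
import Algebra.Properties.Ring as RingProperties
import Algebra.Properties.Semiring.Exp as Exp
import Algebra.Properties.Semiring.Mult as Mult
import Algebra.Properties.Semiring.Sum as Sum
import Algebra.Solver.Ring as RingSolver
import Data.Integer.Properties as ℤ
import Data.Nat.Properties as ℕ
import Relation.Binary.Construct.Add.Extrema.Strict as Extended
import Relation.Binary.Reasoning.PartialOrder as PartialOrderReasoning

-- The only lower bound assumed on `q_m` is 2, so smallness is drawn from the exponent: `2 ^ j`
-- exceeds every prescribed bound, hence so does `X`. Of the `n + 1` factors `X` gained by the
-- approximation, `n` pay for `q′ ^ n` and the last one absorbs the Lipschitz constant. Analyticity
-- acts through a geometric bound on the coefficients, which convergence at one point other than the
-- centre already yields; each centre is therefore shown to be an accumulation point of the domain.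
-- At `ζ` the rationals `r` serve, being distinct from the irrational `ζ`. Further along a segment
-- issuing from `ζ`, the points already known to share the value serve, and the passage to the whole
-- interval is an induction on `[0, 1]` resting on suprema. Infinitely many solutions come from the
-- irrationality of `f(ζ)`: a finite list of rationals keeps a positive distance from it, and any
-- closer approximation is new.

-- The ring homomorphism from the integers, and a ring solver with integer coefficients.

module IntegerEmbedding (ℝ : CompleteOrderedField) where

  open Reals ℝ
  open RingProperties ring public using (-0#≈0#; -‿involutive; -‿distribˡ-*; -‿distribʳ-*; -‿+-comm)
  open Mult semiring using (×-homo-+; ×1-homo-*)
  open OptimisedMult +-monoid using (×ᵤ≈×) renaming (_×_ to _×′_)
  open CommutativeSemigroupProperties +-commutativeSemigroup using (interchange)
  open PartialOrderReasoning (TotalOrder.poset totalOrder)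

  fromℕ-+ : ∀ m n → fromℕ (m ℕ.+ n) ≈ fromℕ m + fromℕ n
  fromℕ-+ = ×-homo-+ 1#

  fromℕ-* : ∀ m n → fromℕ (m ℕ.* n) ≈ fromℕ m * fromℕ n
  fromℕ-* = ×1-homo-*

  fromℤ-⊖ : ∀ m n → fromℤ (m ⊖ n) ≈ fromℕ m - fromℕ n
  fromℤ-⊖ zero    zero    = sym (-‿inverseʳ 0#)
  fromℤ-⊖ zero    (suc n) = sym (+-identityˡ _)
  fromℤ-⊖ (suc m) zero    = sym (trans (+-congˡ -0#≈0#) (+-identityʳ _))
  fromℤ-⊖ (suc m) (suc n) = begin-equality
    fromℤ (suc m ⊖ suc n)                ≡⟨ ≡.cong fromℤ (ℤ.[1+m]⊖[1+n]≡m⊖n m n) ⟩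
    fromℤ (m ⊖ n)                        ≈⟨ fromℤ-⊖ m n ⟩
    fromℕ m - fromℕ n                    ≈⟨ +-identityˡ _ ⟨
    0# + (fromℕ m - fromℕ n)             ≈⟨ +-congʳ (-‿inverseʳ 1#) ⟨
    (1# - 1#) + (fromℕ m - fromℕ n)      ≈⟨ interchange 1# _ _ _ ⟩
    (1# + fromℕ m) + (- 1# - fromℕ n)    ≈⟨ +-congˡ (-‿+-comm 1# _) ⟩
    (1# + fromℕ m) - (1# + fromℕ n)      ∎

  fromℤ-+ : ∀ i j → fromℤ (i ℤ.+ j) ≈ fromℤ i + fromℤ j
  fromℤ-+ (+ m)      (+ n)      = fromℕ-+ m n
  fromℤ-+ (+ m)      -[1+ n ]   = fromℤ-⊖ m (suc n)
  fromℤ-+ -[1+ m ]   (+ n)      = trans (fromℤ-⊖ n (suc m)) (+-comm _ _)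
  fromℤ-+ -[1+ m ]   -[1+ n ]   = begin-equality
    - fromℕ (suc (suc (m ℕ.+ n)))          ≡⟨ ≡.cong (λ k → - fromℕ (suc k)) (ℕ.+-suc m n) ⟨
    - fromℕ (suc m ℕ.+ suc n)              ≈⟨ -‿cong (fromℕ-+ (suc m) (suc n)) ⟩
    - (fromℕ (suc m) + fromℕ (suc n))      ≈⟨ -‿+-comm _ _ ⟨
    - fromℕ (suc m) - fromℕ (suc n)        ∎

  fromℤ-neg : ∀ i → fromℤ (ℤ.- i) ≈ - fromℤ i
  fromℤ-neg (+ zero)  = sym -0#≈0#
  fromℤ-neg (+ suc n) = refl
  fromℤ-neg -[1+ n ]  = sym (-‿involutive _)

  fromℤ-*-+ : ∀ m j → fromℤ (+ m ℤ.* j) ≈ fromℕ m * fromℤ j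
  fromℤ-*-+ m (+ n) = begin-equality
    fromℤ (+ m ℤ.* + n)  ≡⟨ ≡.cong fromℤ (ℤ.pos-* m n) ⟨
    fromℕ (m ℕ.* n)      ≈⟨ fromℕ-* m n ⟩
    fromℕ m * fromℕ n    ∎
  fromℤ-*-+ m -[1+ n ] = begin-equality
    fromℤ (+ m ℤ.* -[1+ n ])         ≡⟨ ≡.cong fromℤ (ℤ.neg-distribʳ-* (+ m) (+ suc n)) ⟨
    fromℤ (ℤ.- (+ m ℤ.* + suc n))    ≈⟨ fromℤ-neg (+ m ℤ.* + suc n) ⟩
    - fromℤ (+ m ℤ.* + suc n)        ≈⟨ -‿cong (fromℤ-*-+ m (+ suc n)) ⟩
    - (fromℕ m * fromℕ (suc n))      ≈⟨ -‿distribʳ-* _ _ ⟩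
    fromℕ m * - fromℕ (suc n)        ∎

  fromℤ-* : ∀ i j → fromℤ (i ℤ.* j) ≈ fromℤ i * fromℤ j
  fromℤ-* (+ m)    j = fromℤ-*-+ m j
  fromℤ-* -[1+ m ] j = begin-equality
    fromℤ (-[1+ m ] ℤ.* j)         ≡⟨ ≡.cong fromℤ (ℤ.neg-distribˡ-* (+ suc m) j) ⟨
    fromℤ (ℤ.- (+ suc m ℤ.* j))    ≈⟨ fromℤ-neg (+ suc m ℤ.* j) ⟩
    - fromℤ (+ suc m ℤ.* j)        ≈⟨ -‿cong (fromℤ-*-+ (suc m) j) ⟩
    - (fromℕ (suc m) * fromℤ j)    ≈⟨ -‿distribˡ-* _ _ ⟩
    - fromℕ (suc m) * fromℤ j      ∎

  -- Unlike fromℤ, this embedding sends 1 to 1# definitionally, so that the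
  -- solver's constants match the goals.
  coefficient : ℤ → Carrier
  coefficient (+ n)    = n ×′ 1#
  coefficient -[1+ n ] = - (suc n ×′ 1#)

  coefficient≈fromℤ : ∀ i → coefficient i ≈ fromℤ i
  coefficient≈fromℤ (+ n)    = sym (×ᵤ≈× n 1#)
  coefficient≈fromℤ -[1+ n ] = -‿cong (sym (×ᵤ≈× (suc n) 1#))

  private
    ℤ-rawRing : RawRing 0ℓ 0ℓ
    ℤ-rawRing = record
      { _≈_ = _≡_ ; _+_ = ℤ._+_ ; _*_ = ℤ._*_ ; -_ = ℤ.-_ ; 0# = + 0 ; 1# = + 1 }

    morphism : ℤ-rawRing -Raw-AlmostCommutative⟶ fromCommutativeRing commutativeRing
    morphism = record
      { ⟦_⟧    = coefficient
      ; +-homo = λ i j → homo i j (i ℤ.+ j) (fromℤ-+ i j) +-cong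
      ; *-homo = λ i j → homo i j (i ℤ.* j) (fromℤ-* i j) *-cong
      ; -‿homo = λ i → trans (coefficient≈fromℤ (ℤ.- i))
                   (trans (fromℤ-neg i) (-‿cong (sym (coefficient≈fromℤ i))))
      ; 0-homo = refl
      ; 1-homo = refl
      }
      where
      homo : ∀ i j k {_∙_ : Carrier → Carrier → Carrier} → fromℤ k ≈ (fromℤ i ∙ fromℤ j) →
             (∀ {x y u v} → x ≈ y → u ≈ v → (x ∙ u) ≈ (y ∙ v)) →
             coefficient k ≈ (coefficient i ∙ coefficient j)
      homo i j k eq cong = trans (coefficient≈fromℤ k)
        (trans eq (cong (sym (coefficient≈fromℤ i)) (sym (coefficient≈fromℤ j))))

    coefficient≟ : ∀ i j → Maybe (coefficient i ≈ coefficient j)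
    coefficient≟ i j with i ℤ.≟ j
    ... | yes ≡.refl = just refl
    ... | no  _      = nothing

  open RingSolver ℤ-rawRing (fromCommutativeRing commutativeRing) morphism coefficient≟ public
    using (solve; _:=_; _:+_; _:*_; _:-_; :-_; con)

-- Order arithmetic, absolute value, powers and completeness.

module OrderedField (em : ExcludedMiddle 0ℓ) (ℝ : CompleteOrderedField) where

  open Reals ℝ public
  open IntegerEmbedding ℝ public
  open PartialOrderReasoning (TotalOrder.poset totalOrder) public
  open Max totalOrder using (x≤x⊔y; x≤y⊔x; ⊔-lub; ⊔-cong; ⊔-comm; x≤y⇒x⊔y≈y; x≤y⇒y⊔x≈y)

  <⇒≱ : ∀ {x y} → x < y → ¬ y ≤ x
  <⇒≱ (x≤y , x≉y) y≤x = x≉y (antisym x≤y y≤x)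

  ≰⇒> : ∀ {x y} → ¬ x ≤ y → y < x
  ≰⇒> {x} {y} x≰y with total x y
  ... | inj₁ x≤y = ⊥-elim (x≰y x≤y)
  ... | inj₂ y≤x = y≤x , λ y≈x → x≰y (≤-reflexive (sym y≈x))

  ≮⇒≥ : ∀ {x y} → ¬ x < y → y ≤ x
  ≮⇒≥ {x} {y} x≮y with em {y ≤ x}
  ... | yes y≤x = y≤x
  ... | no  y≰x = ⊥-elim (x≮y (≰⇒> y≰x))

  <-irrefl : ∀ {x} → ¬ x < x
  <-irrefl x<x = <⇒≱ x<x ≤-refl

  <-≤-trans : ∀ {x y z} → x < y → y ≤ z → x < z
  <-≤-trans {x} {y} {z} x<y y≤z = begin-strict x <⟨ x<y ⟩ y ≤⟨ y≤z ⟩ z ∎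

  ≤-<-trans : ∀ {x y z} → x ≤ y → y < z → x < z
  ≤-<-trans {x} {y} {z} x≤y y<z = begin-strict x ≤⟨ x≤y ⟩ y <⟨ y<z ⟩ z ∎

  <-respˡ-≈ : ∀ {x y z} → x ≈ y → x < z → y < z
  <-respˡ-≈ x≈y = ≤-<-trans (≤-reflexive (sym x≈y))

  <-respʳ-≈ : ∀ {x y z} → x ≈ y → z < x → z < y
  <-respʳ-≈ x≈y z<x = <-≤-trans z<x (≤-reflexive x≈y)

  >⇒≉ : ∀ {x y} → x < y → ¬ y ≈ x
  >⇒≉ (_ , x≉y) y≈x = x≉y (sym y≈x)

  0<1 : 0# < 1#
  0<1 = 0≤1 , λ 0≈1 → 1≉0 (sym 0≈1)

  +-monoʳ-≤ : ∀ z {x y} → x ≤ y → z + x ≤ z + y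
  +-monoʳ-≤ z {x} {y} x≤y = begin
    z + x ≈⟨ +-comm z x ⟩ x + z ≤⟨ +-monoˡ-≤ z x≤y ⟩ y + z ≈⟨ +-comm y z ⟩ z + y ∎

  +-mono-≤ : ∀ {x y u v} → x ≤ y → u ≤ v → x + u ≤ y + v
  +-mono-≤ {x} {y} {u} {v} x≤y u≤v = ≤-trans (+-monoˡ-≤ u x≤y) (+-monoʳ-≤ y u≤v)

  +-cancelʳ-≤ : ∀ z {x y} → x + z ≤ y + z → x ≤ y
  +-cancelʳ-≤ z {x} {y} le = begin
    x             ≈⟨ cancel x z ⟨
    x + z + - z   ≤⟨ +-monoˡ-≤ (- z) le ⟩
    y + z + - z   ≈⟨ cancel y z ⟩
    y             ∎
    where
    cancel : ∀ x z → x + z + - z ≈ x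
    cancel = solve 2 (λ x z → x :+ z :+ :- z := x) refl

  +-monoˡ-< : ∀ z {x y} → x < y → x + z < y + z
  +-monoˡ-< z x<y = ≰⇒> λ le → <⇒≱ x<y (+-cancelʳ-≤ z le)

  +-monoʳ-< : ∀ z {x y} → x < y → z + x < z + y
  +-monoʳ-< z {x} {y} x<y = <-respˡ-≈ (+-comm x z) (<-respʳ-≈ (+-comm y z) (+-monoˡ-< z x<y))

  x≤y⇒0≤y-x : ∀ {x y} → x ≤ y → 0# ≤ y - x
  x≤y⇒0≤y-x {x} x≤y = ≤-respˡ-≈ (-‿inverseʳ x) (+-monoˡ-≤ (- x) x≤y)

  0≤y-x⇒x≤y : ∀ {x y} → 0# ≤ y - x → x ≤ y
  0≤y-x⇒x≤y {x} {y} 0≤y-x =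
    +-cancelʳ-≤ (- x) (≤-respˡ-≈ (sym (-‿inverseʳ x)) 0≤y-x)

  x<y⇒0<y-x : ∀ {x y} → x < y → 0# < y - x
  x<y⇒0<y-x {x} x<y = <-respˡ-≈ (-‿inverseʳ x) (+-monoˡ-< (- x) x<y)

  neg-mono-≤ : ∀ {x y} → x ≤ y → - y ≤ - x
  neg-mono-≤ {x} {y} x≤y = 0≤y-x⇒x≤y (≤-respʳ-≈ (lemma x y) (x≤y⇒0≤y-x x≤y))
    where
    lemma : ∀ x y → y - x ≈ - x - - y
    lemma = solve 2 (λ x y → y :- x := :- x :- :- y) refl

  *-monoʳ-≤ : ∀ {z x y} → 0# ≤ z → x ≤ y → z * x ≤ z * y
  *-monoʳ-≤ {z} {x} {y} 0≤z x≤y = 0≤y-x⇒x≤y (≤-respʳ-≈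
    (solve 3 (λ x y z → z :* (y :- x) := z :* y :- z :* x) refl x y z)
    (*-nonneg 0≤z (x≤y⇒0≤y-x x≤y)))

  *-monoˡ-≤ : ∀ {z x y} → 0# ≤ z → x ≤ y → x * z ≤ y * z
  *-monoˡ-≤ {z} {x} {y} 0≤z x≤y = begin
    x * z ≈⟨ *-comm x z ⟩ z * x ≤⟨ *-monoʳ-≤ 0≤z x≤y ⟩ z * y ≈⟨ *-comm z y ⟩ y * z ∎

  *-mono-≤ : ∀ {x y u v} → 0# ≤ y → 0# ≤ u → x ≤ y → u ≤ v → x * u ≤ y * v
  *-mono-≤ 0≤y 0≤u x≤y u≤v = ≤-trans (*-monoˡ-≤ 0≤u x≤y) (*-monoʳ-≤ 0≤y u≤v)

  ⁻¹-inverseˡ : ∀ {x} → ¬ x ≈ 0# → x ⁻¹ * x ≈ 1#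
  ⁻¹-inverseˡ {x} x≉0 = trans (*-comm (x ⁻¹) x) (⁻¹-inverseʳ x≉0)

  *-cancel⁻¹ : ∀ {x} y → ¬ x ≈ 0# → x ⁻¹ * (x * y) ≈ y
  *-cancel⁻¹ {x} y x≉0 = begin-equality
    x ⁻¹ * (x * y)   ≈⟨ *-assoc _ _ _ ⟨
    x ⁻¹ * x * y     ≈⟨ *-congʳ (⁻¹-inverseˡ x≉0) ⟩
    1# * y           ≈⟨ *-identityˡ y ⟩
    y                ∎

  *-pos : ∀ {x y} → 0# < x → 0# < y → 0# < x * y
  *-pos {x} {y} 0<x 0<y = *-nonneg (proj₁ 0<x) (proj₁ 0<y) , λ 0≈xy →
    >⇒≉ 0<y (begin-equality
      y               ≈⟨ *-cancel⁻¹ y (>⇒≉ 0<x) ⟨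
      x ⁻¹ * (x * y)  ≈⟨ *-congˡ 0≈xy ⟨
      x ⁻¹ * 0#       ≈⟨ zeroʳ _ ⟩
      0#              ∎)

  +-pos : ∀ {x y} → 0# < x → 0# ≤ y → 0# < x + y
  +-pos {x} {y} 0<x 0≤y = <-≤-trans 0<x (≤-respˡ-≈ (+-identityʳ x) (+-monoʳ-≤ x 0≤y))

  +-nonneg : ∀ {x y} → 0# ≤ x → 0# ≤ y → 0# ≤ x + y
  +-nonneg 0≤x 0≤y = ≤-respˡ-≈ (+-identityʳ 0#) (+-mono-≤ 0≤x 0≤y)

  ⁻¹-pos : ∀ {x} → 0# < x → 0# < x ⁻¹
  ⁻¹-pos {x} 0<x = ≰⇒> λ x⁻¹≤0 → <⇒≱ 0<1 (begin
    1#        ≈⟨ ⁻¹-inverseʳ (>⇒≉ 0<x) ⟨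
    x * x ⁻¹  ≤⟨ *-monoʳ-≤ (proj₁ 0<x) x⁻¹≤0 ⟩
    x * 0#    ≈⟨ zeroʳ x ⟩
    0#        ∎)

  *-cancelˡ-≤ : ∀ {z x y} → 0# < z → z * x ≤ z * y → x ≤ y
  *-cancelˡ-≤ {z} {x} {y} 0<z le = begin
    x               ≈⟨ *-cancel⁻¹ x (>⇒≉ 0<z) ⟨
    z ⁻¹ * (z * x)  ≤⟨ *-monoʳ-≤ (proj₁ (⁻¹-pos 0<z)) le ⟩
    z ⁻¹ * (z * y)  ≈⟨ *-cancel⁻¹ y (>⇒≉ 0<z) ⟩
    y               ∎

  *-monoʳ-< : ∀ {z x y} → 0# < z → x < y → z * x < z * y
  *-monoʳ-< 0<z x<y = ≰⇒> λ le → <⇒≱ x<y (*-cancelˡ-≤ 0<z le)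

  *-cancelˡ-< : ∀ {z x y} → 0# ≤ z → z * x < z * y → x < y
  *-cancelˡ-< 0≤z lt = ≰⇒> λ le → <⇒≱ lt (*-monoʳ-≤ 0≤z le)

  x*y≤1⇒x≤y⁻¹ : ∀ {x y} → 0# < y → x * y ≤ 1# → x ≤ y ⁻¹
  x*y≤1⇒x≤y⁻¹ {x} {y} 0<y xy≤1 = *-cancelˡ-≤ 0<y (begin
    y * x     ≈⟨ *-comm y x ⟩
    x * y     ≤⟨ xy≤1 ⟩
    1#        ≈⟨ ⁻¹-inverseʳ (>⇒≉ 0<y) ⟨
    y * y ⁻¹  ∎)

  x≤y⁻¹⇒x*y≤1 : ∀ {x y} → 0# < y → x ≤ y ⁻¹ → x * y ≤ 1#
  x≤y⁻¹⇒x*y≤1 0<y le =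
    ≤-respʳ-≈ (⁻¹-inverseˡ (>⇒≉ 0<y)) (*-monoˡ-≤ (proj₁ 0<y) le)

  smaller : ∀ {x y} → 0# < x → 0# < y → ∃ λ z → 0# < z × z ≤ x × z ≤ y
  smaller {x} {y} 0<x 0<y with total x y
  ... | inj₁ x≤y = x , 0<x , ≤-refl , x≤y
  ... | inj₂ y≤x = y , 0<y , y≤x , ≤-refl

  -- Dividing `δ` by `1# + K` instead of `K` covers `K ≈ 0#` without a case split.
  shrink : ∀ {δ K} → 0# < δ → 0# ≤ K → ∃ λ ε → 0# < ε × ε * K < δ
  shrink {δ} {K} 0<δ 0≤K = ε , 0<ε , (begin-strict
    ε * K                          <⟨ *-monoʳ-< 0<ε K<1+K ⟩
    δ * (1# + K) ⁻¹ * (1# + K)     ≈⟨ *-assoc _ _ _ ⟩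
    δ * ((1# + K) ⁻¹ * (1# + K))   ≈⟨ *-congˡ (⁻¹-inverseˡ (>⇒≉ 0<1+K)) ⟩
    δ * 1#                         ≈⟨ *-identityʳ δ ⟩
    δ                              ∎)
    where
    ε : Carrier
    ε = δ * (1# + K) ⁻¹
    0<1+K : 0# < 1# + K
    0<1+K = +-pos 0<1 0≤K
    0<ε : 0# < ε
    0<ε = *-pos 0<δ (⁻¹-pos 0<1+K)
    K<1+K : K < 1# + K
    K<1+K = <-respˡ-≈ (+-identityˡ K) (+-monoˡ-< K 0<1)

  smaller-multiple : ∀ {x δ K} → 0# < x → 0# < δ → 0# ≤ K → ∃ λ ε → 0# < ε × ε ≤ x × ε * K < δ
  smaller-multiple 0<x 0<δ 0≤K =
    let ε₁ , 0<ε₁ , ε₁K<δ = shrink 0<δ 0≤K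
        ε , 0<ε , ε≤x , ε≤ε₁ = smaller 0<x 0<ε₁
    in ε , 0<ε , ε≤x , ≤-<-trans (*-monoˡ-≤ 0≤K ε≤ε₁) ε₁K<δ

  ≤-by-approximation : ∀ {x y} → (∀ ε → 0# < ε → x ≤ y + ε) → x ≤ y
  ≤-by-approximation {x} {y} x≤y+ = ≮⇒≥ λ y<x →
    -- With `K` equal to `1#`, `shrink` returns half of the gap.
    let ε , 0<ε , ε*1<x-y = shrink (x<y⇒0<y-x y<x) 0≤1 in
    <⇒≱ (begin-strict
      y + ε         <⟨ +-monoʳ-< y (<-respˡ-≈ (*-identityʳ ε) ε*1<x-y) ⟩
      y + (x - y)   ≈⟨ solve 2 (λ x y → y :+ (x :- y) := x) refl x y ⟩
      x             ∎) (x≤y+ ε 0<ε)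

  -- Absolute value

  x≤∣x∣ : ∀ x → x ≤ ∣ x ∣
  x≤∣x∣ x = x≤x⊔y x (- x)

  -x≤∣x∣ : ∀ x → - x ≤ ∣ x ∣
  -x≤∣x∣ x = x≤y⊔x x (- x)

  ∣∣-lub : ∀ {x y} → x ≤ y → - x ≤ y → ∣ x ∣ ≤ y
  ∣∣-lub = ⊔-lub

  ∣∣-cong : ∀ {x y} → x ≈ y → ∣ x ∣ ≈ ∣ y ∣
  ∣∣-cong x≈y = ⊔-cong x≈y (-‿cong x≈y)

  ∣-x∣≈∣x∣ : ∀ x → ∣ - x ∣ ≈ ∣ x ∣
  ∣-x∣≈∣x∣ x = trans (⊔-cong refl (-‿involutive x)) (⊔-comm (- x) x)

  ∣x-y∣≈∣y-x∣ : ∀ x y → ∣ x - y ∣ ≈ ∣ y - x ∣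
  ∣x-y∣≈∣y-x∣ x y = trans
    (∣∣-cong (solve 2 (λ x y → x :- y := :- (y :- x)) refl x y)) (∣-x∣≈∣x∣ (y - x))

  0≤-x : ∀ {x} → x ≤ 0# → 0# ≤ - x
  0≤-x x≤0 = ≤-respˡ-≈ -0#≈0# (neg-mono-≤ x≤0)

  -x≤0 : ∀ {x} → 0# ≤ x → - x ≤ 0#
  -x≤0 0≤x = ≤-respʳ-≈ -0#≈0# (neg-mono-≤ 0≤x)

  0≤x⇒∣x∣≈x : ∀ {x} → 0# ≤ x → ∣ x ∣ ≈ x
  0≤x⇒∣x∣≈x 0≤x = x≤y⇒y⊔x≈y (≤-trans (-x≤0 0≤x) 0≤x)

  x≤0⇒∣x∣≈-x : ∀ {x} → x ≤ 0# → ∣ x ∣ ≈ - x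
  x≤0⇒∣x∣≈-x x≤0 = x≤y⇒x⊔y≈y (≤-trans x≤0 (0≤-x x≤0))

  0≤∣x∣ : ∀ x → 0# ≤ ∣ x ∣
  0≤∣x∣ x with total 0# x
  ... | inj₁ 0≤x = ≤-trans 0≤x (x≤∣x∣ x)
  ... | inj₂ x≤0 = ≤-trans (0≤-x x≤0) (-x≤∣x∣ x)

  ∣x∣≤0⇒x≈0 : ∀ {x} → ∣ x ∣ ≤ 0# → x ≈ 0#
  ∣x∣≤0⇒x≈0 {x} ∣x∣≤0 = antisym (≤-trans (x≤∣x∣ x) ∣x∣≤0) (begin
    0#      ≈⟨ -0#≈0# ⟨
    - 0#    ≤⟨ neg-mono-≤ (≤-trans (-x≤∣x∣ x) ∣x∣≤0) ⟩
    - - x   ≈⟨ -‿involutive x ⟩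
    x       ∎)

  x≉0⇒0<∣x∣ : ∀ {x} → ¬ x ≈ 0# → 0# < ∣ x ∣
  x≉0⇒0<∣x∣ x≉0 = ≰⇒> λ le → x≉0 (∣x∣≤0⇒x≈0 le)

  x-y≈0⇒x≈y : ∀ {x y} → x - y ≈ 0# → x ≈ y
  x-y≈0⇒x≈y {x} {y} eq = begin-equality
    x          ≈⟨ solve 2 (λ x y → x := (x :- y) :+ y) refl x y ⟩
    x - y + y  ≈⟨ +-congʳ eq ⟩
    0# + y     ≈⟨ +-identityˡ y ⟩
    y          ∎

  x≈y⇒x-y≈0 : ∀ {x y} → x ≈ y → x - y ≈ 0#
  x≈y⇒x-y≈0 {x} {y} x≈y = trans (+-congʳ x≈y) (-‿inverseʳ y)

  x≈y⇒∣x-y∣≈0 : ∀ {x y} → x ≈ y → ∣ x - y ∣ ≈ 0#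
  x≈y⇒∣x-y∣≈0 x≈y = trans (∣∣-cong (x≈y⇒x-y≈0 x≈y)) (0≤x⇒∣x∣≈x ≤-refl)

  x≉y⇒0<∣x-y∣ : ∀ {x y} → ¬ x ≈ y → 0# < ∣ x - y ∣
  x≉y⇒0<∣x-y∣ x≉y = x≉0⇒0<∣x∣ λ eq → x≉y (x-y≈0⇒x≈y eq)

  ∣x+y∣≤∣x∣+∣y∣ : ∀ x y → ∣ x + y ∣ ≤ ∣ x ∣ + ∣ y ∣
  ∣x+y∣≤∣x∣+∣y∣ x y = ∣∣-lub (+-mono-≤ (x≤∣x∣ x) (x≤∣x∣ y))
    (≤-respˡ-≈ (-‿+-comm x y) (+-mono-≤ (-x≤∣x∣ x) (-x≤∣x∣ y)))

  ∣x-z∣≤∣x-y∣+∣y-z∣ : ∀ x y z → ∣ x - z ∣ ≤ ∣ x - y ∣ + ∣ y - z ∣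
  ∣x-z∣≤∣x-y∣+∣y-z∣ x y z = ≤-respˡ-≈
    (∣∣-cong (solve 3 (λ x y z → (x :- y) :+ (y :- z) := x :- z) refl x y z))
    (∣x+y∣≤∣x∣+∣y∣ (x - y) (y - z))

  ∣xy∣≈∣x∣∣y∣ : ∀ x y → ∣ x * y ∣ ≈ ∣ x ∣ * ∣ y ∣
  ∣xy∣≈∣x∣∣y∣ x y = by-signs (total 0# x) (total 0# y)
    where
    by-signs : 0# ≤ x ⊎ x ≤ 0# → 0# ≤ y ⊎ y ≤ 0# → ∣ x * y ∣ ≈ ∣ x ∣ * ∣ y ∣
    by-signs (inj₁ 0≤x) (inj₁ 0≤y) = trans (0≤x⇒∣x∣≈x (*-nonneg 0≤x 0≤y))
      (sym (*-cong (0≤x⇒∣x∣≈x 0≤x) (0≤x⇒∣x∣≈x 0≤y)))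
    by-signs (inj₁ 0≤x) (inj₂ y≤0) = trans (x≤0⇒∣x∣≈-x (≤-respʳ-≈ (zeroʳ x) (*-monoʳ-≤ 0≤x y≤0)))
      (trans (-‿distribʳ-* x y) (sym (*-cong (0≤x⇒∣x∣≈x 0≤x) (x≤0⇒∣x∣≈-x y≤0))))
    by-signs (inj₂ x≤0) (inj₁ 0≤y) = trans (x≤0⇒∣x∣≈-x (≤-respʳ-≈ (zeroˡ y) (*-monoˡ-≤ 0≤y x≤0)))
      (trans (-‿distribˡ-* x y) (sym (*-cong (x≤0⇒∣x∣≈-x x≤0) (0≤x⇒∣x∣≈x 0≤y))))
    by-signs (inj₂ x≤0) (inj₂ y≤0) = begin-equality
      ∣ x * y ∣       ≈⟨ ∣∣-cong (solve 2 (λ x y → x :* y := :- x :* :- y) refl x y) ⟩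
      ∣ - x * - y ∣   ≈⟨ 0≤x⇒∣x∣≈x (*-nonneg (0≤-x x≤0) (0≤-x y≤0)) ⟩
      - x * - y       ≈⟨ *-cong (x≤0⇒∣x∣≈-x x≤0) (x≤0⇒∣x∣≈-x y≤0) ⟨
      ∣ x ∣ * ∣ y ∣   ∎

  -- Natural numbers and powers

  0≤fromℕ : ∀ n → 0# ≤ fromℕ n
  0≤fromℕ zero    = ≤-refl
  0≤fromℕ (suc n) = proj₁ (0<fromℕ-suc n)

  fromℕ-mono-≤ : ∀ {m n} → m ℕ.≤ n → fromℕ m ≤ fromℕ n
  fromℕ-mono-≤ {n = n} z≤n = 0≤fromℕ n
  fromℕ-mono-≤ (s≤s m≤n)   = +-monoʳ-≤ 1# (fromℕ-mono-≤ m≤n)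

  fromℕ-cancel-≤ : ∀ {m n} → fromℕ m ≤ fromℕ n → m ℕ.≤ n
  fromℕ-cancel-≤ {m} {n} le with m ℕ.≤? n
  ... | yes m≤n = m≤n
  ... | no  m≰n = ⊥-elim (<⇒≱ (<-≤-trans n<1+n (fromℕ-mono-≤ (ℕ.≰⇒> m≰n))) le)
    where
    n<1+n : fromℕ n < fromℕ (suc n)
    n<1+n = <-respˡ-≈ (+-identityˡ _) (+-monoˡ-< (fromℕ n) 0<1)

  open Exp semiring using (^-assocʳ; ^-congˡ) public
  open CommutativeExp commutativeSemiring using (^-distrib-*) public

  ^-nonneg : ∀ {x} n → 0# ≤ x → 0# ≤ x ^ n
  ^-nonneg zero    0≤x = 0≤1
  ^-nonneg (suc n) 0≤x = *-nonneg 0≤x (^-nonneg n 0≤x)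

  ^-pos : ∀ {x} n → 0# < x → 0# < x ^ n
  ^-pos zero    0<x = 0<1
  ^-pos (suc n) 0<x = *-pos 0<x (^-pos n 0<x)

  1≤^ : ∀ {x} n → 1# ≤ x → 1# ≤ x ^ n
  1≤^         zero    1≤x = ≤-refl
  1≤^ {x} (suc n) 1≤x = ≤-respˡ-≈ (*-identityˡ 1#)
    (*-mono-≤ (≤-trans 0≤1 1≤x) 0≤1 1≤x (1≤^ n 1≤x))

  ^-monoˡ-≤ : ∀ {x y} n → 0# ≤ x → x ≤ y → x ^ n ≤ y ^ n
  ^-monoˡ-≤ zero    0≤x x≤y = ≤-refl
  ^-monoˡ-≤ (suc n) 0≤x x≤y =
    *-mono-≤ (≤-trans 0≤x x≤y) (^-nonneg n 0≤x) x≤y (^-monoˡ-≤ n 0≤x x≤y)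

  ^-monoʳ-≤ : ∀ {x m n} → 1# ≤ x → m ℕ.≤ n → x ^ m ≤ x ^ n
  ^-monoʳ-≤ {n = n} 1≤x z≤n = 1≤^ n 1≤x
  ^-monoʳ-≤ 1≤x (s≤s m≤n)   = *-monoʳ-≤ (≤-trans 0≤1 1≤x) (^-monoʳ-≤ 1≤x m≤n)

  ^-monoˡ-< : ∀ {x y} n .{{_ : ℕ.NonZero n}} → 0# ≤ x → x < y → x ^ n < y ^ n
  ^-monoˡ-< {x} {y} (suc n) 0≤x x<y = begin-strict
    x * x ^ n   ≤⟨ *-monoʳ-≤ 0≤x (^-monoˡ-≤ n 0≤x (proj₁ x<y)) ⟩
    x * y ^ n   ≈⟨ *-comm _ _ ⟩
    y ^ n * x   <⟨ *-monoʳ-< (^-pos n (≤-<-trans 0≤x x<y)) x<y ⟩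
    y ^ n * y   ≈⟨ *-comm _ _ ⟩
    y * y ^ n   ∎

  ^-cancelˡ-≤ : ∀ {x y} n .{{_ : ℕ.NonZero n}} → 0# ≤ y → x ^ n ≤ y ^ n → x ≤ y
  ^-cancelˡ-≤ n 0≤y le = ≮⇒≥ λ y<x → <⇒≱ (^-monoˡ-< n 0≤y y<x) le

  -- Makes the scale `q ^ j` arbitrarily large through `j` alone, uniformly in the denominator `q`.
  n≤b^n : ∀ {b} n → fromℕ 2 ≤ b → fromℕ n ≤ b ^ n
  n≤b^n zero 2≤b = 0≤1
  n≤b^n {b} (suc n) 2≤b = begin
    1# + fromℕ n         ≤⟨ +-mono-≤ (1≤^ n (≤-trans (1≤fromℕ-suc 1) 2≤b)) (n≤b^n n 2≤b) ⟩
    b ^ n + b ^ n        ≈⟨ solve 1 (λ x → x :+ x := (con (+ 1) :+ (con (+ 1) :+ con (+ 0))) :* x) refl (b ^ n) ⟩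
    fromℕ 2 * b ^ n      ≤⟨ *-monoˡ-≤ (≤-trans 0≤1 (1≤^ n (≤-trans (1≤fromℕ-suc 1) 2≤b))) 2≤b ⟩
    b * b ^ n            ∎

  -- If the naturals had a supremum `s`, it would bound every `n + 1`, so `s - 1#` would bound every
  -- `n`, against the minimality of `s`.
  archimedean : ∀ x → ∃ λ n → x < fromℕ n
  archimedean x with em {∃ λ n → x < fromℕ n}
  ... | yes bounded = bounded
  ... | no  unbounded = ⊥-elim (<⇒≱ s-1<s (proj₂ (isSupremum S nonempty above) (s - 1#) s-1-bound))
    where
    S : Carrier → Set
    S y = ∃ λ n → y ≈ fromℕ n
    nonempty : ∃ S
    nonempty = 0# , 0 , refl
    above : ∃ (UpperBound _≤_ S)
    above = x , λ y (n , y≈n) → ≤-respˡ-≈ (sym y≈n) (≮⇒≥ λ x<n → unbounded (n , x<n))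
    s = sup S
    s-1-bound : UpperBound _≤_ S (s - 1#)
    s-1-bound y (n , y≈n) = +-cancelʳ-≤ 1# (begin
      y + 1#           ≈⟨ +-congʳ y≈n ⟩
      fromℕ n + 1#     ≈⟨ +-comm _ _ ⟩
      fromℕ (suc n)    ≤⟨ proj₁ (isSupremum S nonempty above) _ (suc n , refl) ⟩
      s                ≈⟨ solve 1 (λ s → s := s :- con (+ 1) :+ con (+ 1)) refl s ⟩
      s - 1# + 1#      ∎)
    s-1<s : s - 1# < s
    s-1<s = begin-strict
      s - 1#        ≈⟨ +-identityʳ _ ⟨
      s - 1# + 0#   <⟨ +-monoʳ-< (s - 1#) 0<1 ⟩
      s - 1# + 1#   ≈⟨ solve 1 (λ s → s :- con (+ 1) :+ con (+ 1) := s) refl s ⟩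
      s             ∎

  -- The single step plays three roles: base case (its premise is vacuous at `0#`), passage to a
  -- limit (it yields `P t` from the points strictly below `t`) and extension to the right. Applied
  -- at the supremum of the initial segments on which `P` holds, it either covers `1#` or produces a
  -- longer segment.
  real-induction : (P : Carrier → Set) →
    (∀ t → 0# ≤ t → t ≤ 1# → (∀ s → 0# ≤ s → s < t → P s) →
      ∃ λ ε → 0# < ε × ∀ s → t ≤ s → s ≤ t + ε → P s) →
    P 1#
  real-induction P step = reaches-1 (step σ 0≤σ σ≤1 below-σ)
    where
    S : Carrier → Set
    S t = 0# ≤ t × t ≤ 1# × (∀ s → 0# ≤ s → s ≤ t → P s)

    0∈S : S 0#
    0∈S with ε , 0<ε , after ← step 0# ≤-refl 0≤1 (λ s 0≤s s<0 → ⊥-elim (<⇒≱ s<0 0≤s)) =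
      ≤-refl , 0≤1 , λ s 0≤s s≤0 →
        after s 0≤s (≤-trans s≤0 (≤-respʳ-≈ (sym (+-identityˡ ε)) (proj₁ 0<ε)))

    σ : Carrier
    σ = sup S

    σ-sup : IsSupremum _≤_ S σ
    σ-sup = isSupremum S (0# , 0∈S) (1# , λ _ t∈S → proj₁ (proj₂ t∈S))

    0≤σ : 0# ≤ σ
    0≤σ = proj₁ σ-sup 0# 0∈S

    σ≤1 : σ ≤ 1#
    σ≤1 = proj₂ σ-sup 1# λ _ t∈S → proj₁ (proj₂ t∈S)

    below-σ : ∀ s → 0# ≤ s → s < σ → P s
    below-σ s 0≤s s<σ with em {∃ λ t → S t × s < t}
    ... | yes (t , (_ , _ , holds) , s<t) = holds s 0≤s (proj₁ s<t)
    ... | no none = ⊥-elim (<⇒≱ s<σ (proj₂ σ-sup s λ t t∈S → ≮⇒≥ λ s<t → none (t , t∈S , s<t)))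

    reaches-1 : (∃ λ ε → 0# < ε × ∀ s → σ ≤ s → s ≤ σ + ε → P s) → P 1#
    reaches-1 (ε , 0<ε , after) with total (σ + ε) 1#
    ... | inj₂ 1≤σ+ε = after 1# σ≤1 1≤σ+ε
    ... | inj₁ σ+ε≤1 = ⊥-elim (<⇒≱ (<-respˡ-≈ (+-identityʳ σ) (+-monoʳ-< σ 0<ε))
      (proj₁ σ-sup (σ + ε) (+-nonneg 0≤σ (proj₁ 0<ε) , σ+ε≤1 , up-to-σ+ε)))
      where
      up-to-σ+ε : ∀ s → 0# ≤ s → s ≤ σ + ε → P s
      up-to-σ+ε s 0≤s s≤σ+ε with em {σ ≤ s}
      ... | yes σ≤s = after s σ≤s s≤σ+ε
      ... | no  σ≰s = below-σ s 0≤s (≰⇒> σ≰s)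

-- Power series, the Lipschitz estimate and the identity theorem.

module PowerSeries (em : ExcludedMiddle 0ℓ) (ℝ : CompleteOrderedField) where

  open OrderedField em ℝ

  -- Index 0 is exempt because the empty partial sum does not contain the head coefficient, with
  -- which the later ones are compared.
  limit-bound : ∀ {a L x K} → a ⟶ L → (∀ n → ∣ a (suc n) - x ∣ ≤ K) → ∣ L - x ∣ ≤ K
  limit-bound {a} {L} {x} {K} a⟶L close = ≤-by-approximation λ ε 0<ε →
    let N , near = a⟶L ε 0<ε in begin
      ∣ L - x ∣                                ≤⟨ ∣x-z∣≤∣x-y∣+∣y-z∣ L (a (suc N)) x ⟩
      ∣ L - a (suc N) ∣ + ∣ a (suc N) - x ∣    ≈⟨ +-congʳ (∣x-y∣≈∣y-x∣ L _) ⟩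
      ∣ a (suc N) - L ∣ + ∣ a (suc N) - x ∣    ≤⟨ +-mono-≤ (proj₁ (near (suc N) (ℕ.n≤1+n N))) (close N) ⟩
      ε + K                                    ≈⟨ +-comm ε K ⟩
      K + ε                                    ∎

  -- Each step of the induction on `N` adds one early term to the bound.
  eventually-bounded⇒bounded : ∀ (a : ℕ → Carrier) N {K} → 0# ≤ K → (∀ n → N ℕ.≤ n → ∣ a n ∣ ≤ K) →
                               ∃ λ B → 0# ≤ B × ∀ n → ∣ a n ∣ ≤ B
  eventually-bounded⇒bounded a zero {K} 0≤K le = K , 0≤K , λ n → le n z≤n
  eventually-bounded⇒bounded a (suc N) {K} 0≤K le =
    eventually-bounded⇒bounded a N (+-nonneg 0≤K (0≤∣x∣ (a N))) le′
    where
    le′ : ∀ n → N ℕ.≤ n → ∣ a n ∣ ≤ K + ∣ a N ∣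
    le′ n N≤n with ℕ.m≤n⇒m<n∨m≡n N≤n
    ... | inj₁ N<n    = ≤-respˡ-≈ (+-identityʳ _) (+-mono-≤ (le n N<n) (0≤∣x∣ (a N)))
    ... | inj₂ ≡.refl = ≤-respˡ-≈ (+-identityˡ _) (+-monoˡ-≤ ∣ a N ∣ 0≤K)

  -- Horner's form: removing the head coefficient becomes a structural recursion on the shifted
  -- sequence `c ∘ suc`.
  partialSum : (ℕ → Carrier) → Carrier → ℕ → Carrier
  partialSum c h zero    = 0#
  partialSum c h (suc n) = c 0 + h * partialSum (c ∘ suc) h n

  sum≈partialSum : ∀ c h n → sum {n} (λ i → c (toℕ i) * h ^ toℕ i) ≈ partialSum c h n
  sum≈partialSum c h zero    = refl
  sum≈partialSum c h (suc n) = +-cong (*-identityʳ (c 0)) (begin-equality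
    sum {n} (λ i → c (suc (toℕ i)) * (h * h ^ toℕ i))
      ≈⟨ sum-cong-≋ {n} (λ i → solve 3 (λ c h y → c :* (h :* y) := h :* (c :* y)) refl
           (c (suc (toℕ i))) h (h ^ toℕ i)) ⟩
    sum {n} (λ i → h * (c (suc (toℕ i)) * h ^ toℕ i))
      ≈⟨ *-distribˡ-sum {n} h (λ i → c (suc (toℕ i)) * h ^ toℕ i) ⟨
    h * sum {n} (λ i → c (suc (toℕ i)) * h ^ toℕ i)
      ≈⟨ *-congˡ (sum≈partialSum (c ∘ suc) h n) ⟩
    h * partialSum (c ∘ suc) h n ∎)
    where open Sum semiring using (sum-cong-≋; *-distribˡ-sum)

  partialSum-step : ∀ c h n → partialSum c h (suc n) - partialSum c h n ≈ c n * h ^ n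
  partialSum-step c h zero    = solve 2 (λ c h → c :+ h :* con (+ 0) :- con (+ 0) := c :* con (+ 1)) refl (c 0) h
  partialSum-step c h (suc n) = begin-equality
    (c 0 + h * S (suc n)) - (c 0 + h * S n)
      ≈⟨ solve 4 (λ c h x y → (c :+ h :* x) :- (c :+ h :* y) := h :* (x :- y)) refl (c 0) h _ _ ⟩
    h * (S (suc n) - S n)           ≈⟨ *-congˡ (partialSum-step (c ∘ suc) h n) ⟩
    h * (c (suc n) * h ^ n)         ≈⟨ solve 3 (λ c h x → h :* (c :* x) := c :* (h :* x)) refl _ _ _ ⟩
    c (suc n) * (h * h ^ n)         ∎
    where
    S : ℕ → Carrier
    S = partialSum (c ∘ suc) h

  partialSum-zero : ∀ {c} h n → (∀ i → c i ≈ 0#) → partialSum c h n ≈ 0#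
  partialSum-zero h zero c≈0 = refl
  partialSum-zero h (suc n) c≈0 = trans
    (+-cong (c≈0 0) (trans (*-congˡ (partialSum-zero h n (c≈0 ∘ suc))) (zeroʳ h))) (+-identityˡ 0#)

  -- A Cauchy estimate, with `s` as the reciprocal of a radius. Shifting the sequence keeps `s` and
  -- multiplies `B` by `s`, so inductions over `c` can generalise over `B`.
  record GeometricBound (c : ℕ → Carrier) (B s : Carrier) : Set where
    constructor geometric
    field
      B-nonneg : 0# ≤ B
      s-nonneg : 0# ≤ s
      ∣c∣≤B*s^ : ∀ n → ∣ c n ∣ ≤ B * s ^ n

  open GeometricBound

  GeometricBound-shift : ∀ {c B s} → GeometricBound c B s → GeometricBound (c ∘ suc) (B * s) s
  GeometricBound-shift (geometric 0≤B 0≤s le) = geometric (*-nonneg 0≤B 0≤s) 0≤s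
    λ n → ≤-respʳ-≈ (sym (*-assoc _ _ _)) (le (suc n))

  -- The smallness of `h` makes the geometric ratio at most one half, and the bound reproduces
  -- itself: the head contributes `B`, and `∣ h ∣` times the tail bound `B * s + B * s` contributes
  -- at most another `B`.
  partialSum-bound : ∀ {c B s h} → GeometricBound c B s → ∣ h ∣ * (s + s) ≤ 1# →
                     ∀ n → ∣ partialSum c h n ∣ ≤ B + B
  partialSum-bound g small zero = ≤-respˡ-≈ (sym (0≤x⇒∣x∣≈x ≤-refl)) (+-nonneg (B-nonneg g) (B-nonneg g))
  partialSum-bound {c} {B} {s} {h} g small (suc n) = begin
    ∣ c 0 + h * S ∣                      ≤⟨ ∣x+y∣≤∣x∣+∣y∣ _ _ ⟩
    ∣ c 0 ∣ + ∣ h * S ∣                  ≈⟨ +-congˡ (∣xy∣≈∣x∣∣y∣ h S) ⟩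
    ∣ c 0 ∣ + ∣ h ∣ * ∣ S ∣              ≤⟨ +-mono-≤ (∣c∣≤B*s^ g 0)
                                             (*-monoʳ-≤ (0≤∣x∣ h) (partialSum-bound (GeometricBound-shift g) small n)) ⟩
    B * 1# + ∣ h ∣ * (B * s + B * s)     ≈⟨ solve 3 (λ b s h → b :* con (+ 1) :+ h :* (b :* s :+ b :* s)
                                             := b :+ b :* (h :* (s :+ s))) refl B s ∣ h ∣ ⟩
    B + B * (∣ h ∣ * (s + s))            ≤⟨ +-monoʳ-≤ B (*-monoʳ-≤ (B-nonneg g) small) ⟩
    B + B * 1#                           ≈⟨ +-congˡ (*-identityʳ B) ⟩
    B + B                                ∎
    where S = partialSum (c ∘ suc) h n

  -- Everything after the head is `h` times a bounded tail. Linearity in `∣ h ∣` serves both the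
  -- Lipschitz estimate and the vanishing of the head at accumulating zeros.
  limit-near-head : ∀ {c B s h L} → GeometricBound c B s → ∣ h ∣ * (s + s) ≤ 1# →
                    partialSum c h ⟶ L → ∣ L - c 0 ∣ ≤ ∣ h ∣ * (B * s + B * s)
  limit-near-head {c} {B} {s} {h} g small lim = limit-bound lim λ n → begin
    ∣ (c 0 + h * S n) - c 0 ∣       ≈⟨ ∣∣-cong (solve 2 (λ c x → c :+ x :- c := x) refl (c 0) (h * S n)) ⟩
    ∣ h * S n ∣                     ≈⟨ ∣xy∣≈∣x∣∣y∣ h (S n) ⟩
    ∣ h ∣ * ∣ S n ∣                 ≤⟨ *-monoʳ-≤ (0≤∣x∣ h) (partialSum-bound (GeometricBound-shift g) small n) ⟩
    ∣ h ∣ * (B * s + B * s)         ∎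
    where
    S : ℕ → Carrier
    S = partialSum (c ∘ suc) h

  1^n≈1 : ∀ n → 1# ^ n ≈ 1#
  1^n≈1 zero    = refl
  1^n≈1 (suc n) = trans (*-identityˡ _) (1^n≈1 n)

  ∣x^n∣≈∣x∣^n : ∀ x n → ∣ x ^ n ∣ ≈ ∣ x ∣ ^ n
  ∣x^n∣≈∣x∣^n x zero    = 0≤x⇒∣x∣≈x 0≤1
  ∣x^n∣≈∣x∣^n x (suc n) = trans (∣xy∣≈∣x∣∣y∣ x (x ^ n)) (*-congˡ (∣x^n∣≈∣x∣^n x n))

  -- A term is the difference of two consecutive partial sums, both eventually within `1#` of the
  -- limit, so the terms are bounded; dividing by `∣ h ∣ ^ n` isolates the coefficient.
  convergent⇒GeometricBound : ∀ {c h L} → ¬ h ≈ 0# → partialSum c h ⟶ L →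
                              ∃ λ B → GeometricBound c B (∣ h ∣ ⁻¹)
  convergent⇒GeometricBound {c} {h} {L} h≉0 lim =
    let B , 0≤B , terms≤B = eventually-bounded⇒bounded (λ n → c n * h ^ n) N (+-nonneg 0≤1 0≤1) terms≤2 in
    B , geometric 0≤B (proj₁ (⁻¹-pos 0<∣h∣)) λ n → begin
      ∣ c n ∣                                    ≈⟨ *-identityʳ _ ⟨
      ∣ c n ∣ * 1#                               ≈⟨ *-congˡ (1^n≈1 n) ⟨
      ∣ c n ∣ * 1# ^ n                           ≈⟨ *-congˡ (^-congˡ n (⁻¹-inverseʳ (>⇒≉ 0<∣h∣))) ⟨
      ∣ c n ∣ * (∣ h ∣ * ∣ h ∣ ⁻¹) ^ n           ≈⟨ *-congˡ (^-distrib-* ∣ h ∣ (∣ h ∣ ⁻¹) n) ⟩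
      ∣ c n ∣ * (∣ h ∣ ^ n * (∣ h ∣ ⁻¹) ^ n)     ≈⟨ *-assoc _ _ _ ⟨
      ∣ c n ∣ * ∣ h ∣ ^ n * (∣ h ∣ ⁻¹) ^ n       ≈⟨ *-congʳ (*-congˡ (∣x^n∣≈∣x∣^n h n)) ⟨
      ∣ c n ∣ * ∣ h ^ n ∣ * (∣ h ∣ ⁻¹) ^ n       ≈⟨ *-congʳ (∣xy∣≈∣x∣∣y∣ (c n) (h ^ n)) ⟨
      ∣ c n * h ^ n ∣ * (∣ h ∣ ⁻¹) ^ n           ≤⟨ *-monoˡ-≤ (^-nonneg n (proj₁ (⁻¹-pos 0<∣h∣))) (terms≤B n) ⟩
      B * (∣ h ∣ ⁻¹) ^ n                         ∎
    where
    0<∣h∣ = x≉0⇒0<∣x∣ h≉0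
    N    = proj₁ (lim 1# 0<1)
    near = proj₂ (lim 1# 0<1)
    S : ℕ → Carrier
    S = partialSum c h
    terms≤2 : ∀ n → N ℕ.≤ n → ∣ c n * h ^ n ∣ ≤ 1# + 1#
    terms≤2 n N≤n = begin
      ∣ c n * h ^ n ∣                      ≈⟨ ∣∣-cong (partialSum-step c h n) ⟨
      ∣ S (suc n) - S n ∣                  ≤⟨ ∣x-z∣≤∣x-y∣+∣y-z∣ _ L _ ⟩
      ∣ S (suc n) - L ∣ + ∣ L - S n ∣      ≈⟨ +-congˡ (∣x-y∣≈∣y-x∣ L (S n)) ⟩
      ∣ S (suc n) - L ∣ + ∣ S n - L ∣      ≤⟨ +-mono-≤ (proj₁ (near (suc n) (ℕ.m≤n⇒m≤1+n N≤n))) (proj₁ (near n N≤n)) ⟩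
      1# + 1#                              ∎

  ZerosAccumulate : (ℕ → Carrier) → Set
  ZerosAccumulate c = ∀ δ → 0# < δ → ∃ λ h → ¬ h ≈ 0# × ∣ h ∣ < δ × partialSum c h ⟶ 0#

  ZerosAccumulate⇒head≈0 : ∀ {c B s} → GeometricBound c B s → ZerosAccumulate c → c 0 ≈ 0#
  ZerosAccumulate⇒head≈0 {c} {B} {s} g zeros = ∣x∣≤0⇒x≈0 (≤-by-approximation λ ε 0<ε →
    let δ₁ , 0<δ₁ , δ₁[s+s]<1 = shrink 0<1 0≤s+s
        δ , 0<δ , δ≤δ₁ , δK<ε = smaller-multiple 0<δ₁ 0<ε 0≤K
        h , _ , ∣h∣<δ , lim = zeros δ 0<δ
    in begin
      ∣ c 0 ∣         ≈⟨ ∣-x∣≈∣x∣ _ ⟨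
      ∣ - c 0 ∣       ≈⟨ ∣∣-cong (+-identityˡ _) ⟨
      ∣ 0# - c 0 ∣    ≤⟨ limit-near-head g (begin
                           ∣ h ∣ * (s + s)       ≤⟨ *-monoˡ-≤ 0≤s+s (≤-trans (proj₁ ∣h∣<δ) δ≤δ₁) ⟩
                           δ₁ * (s + s)          ≤⟨ proj₁ δ₁[s+s]<1 ⟩
                           1#                    ∎) lim ⟩
      ∣ h ∣ * K       ≤⟨ *-monoˡ-≤ 0≤K (proj₁ ∣h∣<δ) ⟩
      δ * K           ≤⟨ proj₁ δK<ε ⟩
      ε               ≈⟨ +-identityˡ ε ⟨
      0# + ε          ∎)
    where
    K : Carrier
    K = B * s + B * s
    0≤s+s : 0# ≤ s + s
    0≤s+s = +-nonneg (s-nonneg g) (s-nonneg g)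
    0≤K : 0# ≤ K
    0≤K = +-nonneg (*-nonneg (B-nonneg g) (s-nonneg g)) (*-nonneg (B-nonneg g) (s-nonneg g))

  divide-by-h : ∀ {c h} → c 0 ≈ 0# → ¬ h ≈ 0# → partialSum c h ⟶ 0# → partialSum (c ∘ suc) h ⟶ 0#
  divide-by-h {c} {h} c₀≈0 h≉0 lim ε 0<ε =
    -- As the head vanishes, `n + 1` terms of the original series make `h` times `n` terms of the
    -- shifted one; the tolerance is scaled accordingly.
    let N , near = lim (∣ h ∣ * ε) (*-pos (x≉0⇒0<∣x∣ h≉0) 0<ε) in
    N , λ n N≤n → *-cancelˡ-< (0≤∣x∣ h) (begin-strict
      ∣ h ∣ * ∣ S n - 0# ∣       ≈⟨ ∣xy∣≈∣x∣∣y∣ h _ ⟨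
      ∣ h * (S n - 0#) ∣         ≈⟨ ∣∣-cong (solve 2 (λ h x → h :* (x :- con (+ 0)) := con (+ 0) :+ h :* x :- con (+ 0)) refl h (S n)) ⟩
      ∣ 0# + h * S n - 0# ∣      ≈⟨ ∣∣-cong (+-congʳ (+-congʳ c₀≈0)) ⟨
      ∣ c 0 + h * S n - 0# ∣     <⟨ near (suc n) (ℕ.m≤n⇒m≤1+n N≤n) ⟩
      ∣ h ∣ * ε                  ∎)
    where
    S : ℕ → Carrier
    S = partialSum (c ∘ suc) h

  -- Once the head vanishes, dividing by `h` keeps the same nonzero zeros, so the shifted series
  -- satisfies both hypotheses again.
  ZerosAccumulate⇒coefficients≈0 : ∀ {c B s} → GeometricBound c B s → ZerosAccumulate c → ∀ n → c n ≈ 0#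
  ZerosAccumulate⇒coefficients≈0 g zeros zero    = ZerosAccumulate⇒head≈0 g zeros
  ZerosAccumulate⇒coefficients≈0 {c} g zeros (suc n) =
    ZerosAccumulate⇒coefficients≈0 (GeometricBound-shift g) (λ δ 0<δ →
      let h , h≉0 , ∣h∣<δ , lim = zeros δ 0<δ in
      h , h≉0 , ∣h∣<δ , divide-by-h {c} (ZerosAccumulate⇒head≈0 g zeros) h≉0 lim) n

  Convex : Pred Carrier 0ℓ → Set
  Convex D = ∀ {x y t} → D x → D y → 0# ≤ t → t ≤ 1# → D (x + t * (y - x))

  -- Analytic functions

  module AnalyticFunction {D : Pred Carrier 0ℓ} (f : Func (Subsetoid D) setoid) where

    f[_] : ∀ {x} → D x → Carrier
    f[_] {x} x∈D = Func.to f (x , x∈D)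

    -- Excluding `y` itself matters: at `h ≈ 0#` the series reduces to its head and says nothing
    -- about the other coefficients.
    AccumulatesAt : Carrier → Set
    AccumulatesAt y = ∀ δ → 0# < δ → ∃ λ x → D x × ¬ x ≈ y × ∣ x - y ∣ < δ

    record Expansion (y : Carrier) : Set where
      field
        {c}         : ℕ → Carrier
        {ρ B s}     : Carrier
        0<ρ         : 0# < ρ
        bound       : GeometricBound c B s
        convergence : ∀ {x} (x∈D : D x) → ∣ x - y ∣ < ρ → partialSum c (x - y) ⟶ f[ x∈D ]

    expansion : RealAnalytic f → ∀ {y} → D y → AccumulatesAt y → Expansion y
    expansion analytic {y} y∈D acc
      with c , ρ , 0<ρ , series ← analytic y y∈D
      with x₁ , x₁∈D , x₁≉y , near ← acc ρ 0<ρ = record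
      { 0<ρ         = 0<ρ
      ; bound       = proj₂ (convergent⇒GeometricBound (λ eq → x₁≉y (x-y≈0⇒x≈y eq)) (convergence x₁∈D near))
      ; convergence = convergence
      }
      where
      convergence : ∀ {x} (x∈D : D x) → ∣ x - y ∣ < ρ → partialSum c (x - y) ⟶ f[ x∈D ]
      convergence {x} x∈D near ε 0<ε =
        let N , lim = series x x∈D near ε 0<ε in
        N , λ n N≤n → <-respˡ-≈ (∣∣-cong (+-congʳ (sum≈partialSum c (x - y) n))) (lim n N≤n)

    LipschitzAt : ∀ {y} → D y → Set
    LipschitzAt {y} y∈D = ∃ λ K → ∃ λ δ → 0# ≤ K × 0# < δ ×
      ∀ {x} (x∈D : D x) → ∣ x - y ∣ < δ → ∣ f[ x∈D ] - f[ y∈D ] ∣ ≤ ∣ x - y ∣ * K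

    analytic⇒LipschitzAt : RealAnalytic f → ∀ {y} (y∈D : D y) → AccumulatesAt y → LipschitzAt y∈D
    analytic⇒LipschitzAt analytic {y} y∈D acc =
      let δ , 0<δ , δ≤ρ , δ[s+s]<1 = smaller-multiple 0<ρ 0<1 0≤s+s
          near-head : ∀ {x} (x∈D : D x) → ∣ x - y ∣ < δ → ∣ f[ x∈D ] - c 0 ∣ ≤ ∣ x - y ∣ * K
          near-head {x} x∈D near = limit-near-head bound (begin
            ∣ x - y ∣ * (s + s)    ≤⟨ *-monoˡ-≤ 0≤s+s (proj₁ near) ⟩
            δ * (s + s)            ≤⟨ proj₁ δ[s+s]<1 ⟩
            1#                     ∎) (convergence x∈D (<-≤-trans near δ≤ρ))
          ∣y-y∣≈0 : ∣ y - y ∣ ≈ 0#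
          ∣y-y∣≈0 = x≈y⇒∣x-y∣≈0 refl
          -- The estimate taken at the centre itself, where its right-hand side vanishes, identifies
          -- the head with the value.
          fy≈c₀ : f[ y∈D ] ≈ c 0
          fy≈c₀ = x-y≈0⇒x≈y (∣x∣≤0⇒x≈0 (begin
            ∣ f[ y∈D ] - c 0 ∣               ≤⟨ near-head y∈D (<-respˡ-≈ (sym ∣y-y∣≈0) 0<δ) ⟩
            ∣ y - y ∣ * K      ≈⟨ *-congʳ ∣y-y∣≈0 ⟩
            0# * K             ≈⟨ zeroˡ _ ⟩
            0#                               ∎))
      in K , δ , 0≤K , 0<δ , λ x∈D near →
        ≤-respˡ-≈ (∣∣-cong (+-congˡ (-‿cong (sym fy≈c₀)))) (near-head x∈D near)
      where
      open Expansion (expansion analytic y∈D acc)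
      K = B * s + B * s
      0≤s+s = +-nonneg (s-nonneg bound) (s-nonneg bound)
      0≤K = +-nonneg (*-nonneg (B-nonneg bound) (s-nonneg bound)) (*-nonneg (B-nonneg bound) (s-nonneg bound))

    ValueAccumulatesAt : Carrier → Carrier → Set
    ValueAccumulatesAt v y =
      ∀ δ → 0# < δ → ∃ λ x → ∃ λ (x∈D : D x) → ¬ x ≈ y × ∣ x - y ∣ < δ × f[ x∈D ] ≈ v

    ValueAccumulatesAt⇒AccumulatesAt : ∀ {v y} → ValueAccumulatesAt v y → AccumulatesAt y
    ValueAccumulatesAt⇒AccumulatesAt acc δ 0<δ =
      let x , x∈D , x≉y , near , _ = acc δ 0<δ in x , x∈D , x≉y , near

    LocallyConstantAt : Carrier → Carrier → Set
    LocallyConstantAt v y = ∃ λ ρ → 0# < ρ × ∀ {x} (x∈D : D x) → ∣ x - y ∣ < ρ → f[ x∈D ] ≈ v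

    -- Subtracting `v` from the head turns points of value `v` into zeros. All modified coefficients
    -- then vanish, so every nonempty partial sum of the original series equals `v`.
    local-identity : RealAnalytic f → ∀ {v y} → D y → ValueAccumulatesAt v y → LocallyConstantAt v y
    local-identity analytic {v} {y} y∈D acc = ρ , 0<ρ , constant
      where
      open Expansion (expansion analytic y∈D (ValueAccumulatesAt⇒AccumulatesAt acc))

      c′ : ℕ → Carrier
      c′ zero    = c 0 - v
      c′ (suc n) = c (suc n)

      partialSum-c′ : ∀ h n → partialSum c′ h (suc n) ≈ partialSum c h (suc n) - v
      partialSum-c′ h n = solve 3 (λ c v x → c :- v :+ x := c :+ x :- v) refl (c 0) v _

      zeros : ∀ {x} (x∈D : D x) → ∣ x - y ∣ < ρ → f[ x∈D ] ≈ v → partialSum c′ (x - y) ⟶ 0#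
      -- The threshold moves up by one because the two partial sums differ by `v` only from one term
      -- on.
      zeros {x} x∈D near fx≈v ε 0<ε with N , lim ← convergence x∈D near ε 0<ε = suc N , λ where
        (suc n) (s≤s N≤n) → <-respˡ-≈ (∣∣-cong (begin-equality
          partialSum c (x - y) (suc n) - f[ x∈D ]    ≈⟨ +-congˡ (-‿cong fx≈v) ⟩
          partialSum c (x - y) (suc n) - v           ≈⟨ partialSum-c′ (x - y) n ⟨
          partialSum c′ (x - y) (suc n)              ≈⟨ solve 1 (λ z → z := z :- con (+ 0)) refl _ ⟩
          partialSum c′ (x - y) (suc n) - 0#         ∎)) (lim (suc n) (ℕ.m≤n⇒m≤1+n N≤n))

      accumulate : ZerosAccumulate c′
      accumulate δ 0<δ =
        let δ′ , 0<δ′ , δ′≤δ , δ′≤ρ = smaller 0<δ 0<ρ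
            x , x∈D , x≉y , near , fx≈v = acc δ′ 0<δ′
        in x - y , (λ eq → x≉y (x-y≈0⇒x≈y eq)) , <-≤-trans near δ′≤δ ,
           zeros x∈D (<-≤-trans near δ′≤ρ) fx≈v

      -- Read off from convergence of the modified series at one of its own zeros.
      geo′ : ∃ λ B′ → ∃ λ s′ → GeometricBound c′ B′ s′
      geo′ with x , x∈D , x≉y , near , fx≈v ← acc ρ 0<ρ =
        _ , _ , proj₂ (convergent⇒GeometricBound (λ eq → x≉y (x-y≈0⇒x≈y eq)) (zeros x∈D near fx≈v))

      constant : ∀ {x} (x∈D : D x) → ∣ x - y ∣ < ρ → f[ x∈D ] ≈ v
      constant {x} x∈D near = x-y≈0⇒x≈y (∣x∣≤0⇒x≈0 (limit-bound (convergence x∈D near) λ n → begin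
        ∣ partialSum c (x - y) (suc n) - v ∣   ≈⟨ ∣∣-cong (partialSum-c′ (x - y) n) ⟨
        ∣ partialSum c′ (x - y) (suc n) ∣      ≈⟨ ∣∣-cong (partialSum-zero (x - y) (suc n)
                                                   (ZerosAccumulate⇒coefficients≈0 (proj₂ (proj₂ geo′)) accumulate)) ⟩
        ∣ 0# ∣                                 ≈⟨ 0≤x⇒∣x∣≈x ≤-refl ⟩
        0#                                     ∎))

    LocallyConstantAt-self : ∀ {v x y} (x∈D : D x) → x ≈ y → LocallyConstantAt v y → f[ x∈D ] ≈ v
    LocallyConstantAt-self x∈D x≈y (ρ , 0<ρ , constant) =
      constant x∈D (<-respˡ-≈ (sym (x≈y⇒∣x-y∣≈0 x≈y)) 0<ρ)

    -- Real induction along the segment `γ` from `y` to `x`: earlier points of value `v` accumulate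
    -- at `γ t`, and `local-identity` carries the value beyond `t`. The case `x ≈ y` is split off
    -- because a degenerate segment has no earlier points distinct from `γ t`.
    identity-theorem : RealAnalytic f → Convex D → ∀ {v y} → D y → ValueAccumulatesAt v y →
                       ∀ {x} (x∈D : D x) → f[ x∈D ] ≈ v
    identity-theorem analytic convex {v} {y} y∈D acc {x} x∈D with em {x ≈ y}
    ... | yes x≈y = LocallyConstantAt-self x∈D x≈y (local-identity analytic y∈D acc)
    ... | no x≉y = trans (Func.cong f {x , x∈D} {γ 1# , γ1∈D} (sym γ1≈x)) (real-induction P step γ1∈D)
      where
      d : Carrier
      d = x - y

      0<∣d∣ : 0# < ∣ d ∣
      0<∣d∣ = x≉y⇒0<∣x-y∣ x≉y

      γ : Carrier → Carrier
      γ t = y + t * d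

      γ∈D : ∀ {t} → 0# ≤ t → t ≤ 1# → D (γ t)
      γ∈D = convex y∈D x∈D

      γ1∈D : D (γ 1#)
      γ1∈D = γ∈D 0≤1 ≤-refl

      γ1≈x : γ 1# ≈ x
      γ1≈x = solve 2 (λ x y → y :+ con (+ 1) :* (x :- y) := x) refl x y

      ∣γ-γ∣ : ∀ s t → ∣ γ s - γ t ∣ ≈ ∣ s - t ∣ * ∣ d ∣
      ∣γ-γ∣ s t = trans (∣∣-cong (trans
        (solve 3 (λ y p q → (y :+ p) :- (y :+ q) := p :- q) refl y (s * d) (t * d))
        (solve 3 (λ d s t → s :* d :- t :* d := (s :- t) :* d) refl d s t)))
        (∣xy∣≈∣x∣∣y∣ (s - t) d)

      -- Membership is a premise because the extension to the right may pass `1#`, where `γ` may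
      -- leave `D`.
      P : Pred Carrier 0ℓ
      P s = (γs∈D : D (γ s)) → f[ γs∈D ] ≈ v

      -- At the start of the segment there are no earlier points; the accumulation given at `y`
      -- replaces them.
      acc-at-y : ∀ {t} → t ≈ 0# → ValueAccumulatesAt v (γ t)
      acc-at-y {t} t≈0 δ 0<δ with z , z∈D , z≉y , near , fz≈v ← acc δ 0<δ =
        z , z∈D , (λ z≈γt → z≉y (trans z≈γt γt≈y)) ,
        <-respˡ-≈ (∣∣-cong (+-congˡ (-‿cong (sym γt≈y)))) near , fz≈v
        where
        γt≈y : γ t ≈ y
        γt≈y = trans (+-congˡ (trans (*-congʳ t≈0) (zeroˡ d))) (+-identityʳ y)

      point-before : ∀ {t δ ε} → 0# < ε → ε ≤ t → t ≤ 1# → ε * ∣ d ∣ < δ → (∀ s → 0# ≤ s → s < t → P s) →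
                     ∃ λ z → ∃ λ (z∈D : D z) → ¬ z ≈ γ t × ∣ z - γ t ∣ < δ × f[ z∈D ] ≈ v
      point-before {t} {δ} {ε} 0<ε ε≤t t≤1 ε∣d∣<δ before =
        γ s , γs∈D , γs≉γt , <-respˡ-≈ (sym distance) ε∣d∣<δ , before s 0≤s s<t γs∈D
        where
        s : Carrier
        s = t - ε
        0≤s : 0# ≤ s
        0≤s = x≤y⇒0≤y-x ε≤t
        s<t : s < t
        s<t = <-respˡ-≈ (+-identityʳ s) (<-respʳ-≈
          (solve 2 (λ t e → t :- e :+ e := t) refl t ε) (+-monoʳ-< s 0<ε))
        γs∈D : D (γ s)
        γs∈D = γ∈D 0≤s (≤-trans (proj₁ s<t) t≤1)
        distance : ∣ γ s - γ t ∣ ≈ ε * ∣ d ∣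
        distance = trans (∣γ-γ∣ s t) (*-congʳ (begin-equality
          ∣ t - ε - t ∣     ≈⟨ ∣∣-cong (solve 2 (λ s d → s :- d :- s := :- d) refl t ε) ⟩
          ∣ - ε ∣           ≈⟨ ∣-x∣≈∣x∣ ε ⟩
          ∣ ε ∣             ≈⟨ 0≤x⇒∣x∣≈x (proj₁ 0<ε) ⟩
          ε                 ∎))
        γs≉γt : ¬ γ s ≈ γ t
        γs≉γt γs≈γt = <-irrefl (<-respʳ-≈ (trans (sym distance) (x≈y⇒∣x-y∣≈0 γs≈γt)) (*-pos 0<ε 0<∣d∣))

      acc-from-left : ∀ {t} → 0# < t → t ≤ 1# → (∀ s → 0# ≤ s → s < t → P s) → ValueAccumulatesAt v (γ t)
      acc-from-left {t} 0<t t≤1 before δ 0<δ =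
        let ε , 0<ε , ε≤t , ε∣d∣<δ = smaller-multiple 0<t 0<δ (proj₁ 0<∣d∣)
        in point-before 0<ε ε≤t t≤1 ε∣d∣<δ before

      acc-at : ∀ {t} → 0# ≤ t → t ≤ 1# → (∀ s → 0# ≤ s → s < t → P s) → ValueAccumulatesAt v (γ t)
      acc-at {t} 0≤t t≤1 before with em {t ≤ 0#}
      ... | yes t≤0 = acc-at-y (antisym t≤0 0≤t)
      ... | no  t≰0 = acc-from-left (≰⇒> t≰0) t≤1 before

      extend : ∀ {t} → LocallyConstantAt v (γ t) → ∃ λ ε → 0# < ε × ∀ s → t ≤ s → s ≤ t + ε → P s
      extend {t} (ρ , 0<ρ , constant) =
        let ε , 0<ε , _ , ε∣d∣<ρ = smaller-multiple 0<1 0<ρ (proj₁ 0<∣d∣) in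
        ε , 0<ε , λ s t≤s s≤t+ε γs∈D → constant γs∈D (begin-strict
          ∣ γ s - γ t ∣        ≈⟨ ∣γ-γ∣ s t ⟩
          ∣ s - t ∣ * ∣ d ∣    ≈⟨ *-congʳ (0≤x⇒∣x∣≈x (x≤y⇒0≤y-x t≤s)) ⟩
          (s - t) * ∣ d ∣      ≤⟨ *-monoˡ-≤ (proj₁ 0<∣d∣) (+-monoˡ-≤ (- t) s≤t+ε) ⟩
          (t + ε - t) * ∣ d ∣  ≈⟨ *-congʳ (solve 2 (λ s e → s :+ e :- s := e) refl t ε) ⟩
          ε * ∣ d ∣            <⟨ ε∣d∣<ρ ⟩
          ρ                    ∎)

      step : ∀ t → 0# ≤ t → t ≤ 1# → (∀ s → 0# ≤ s → s < t → P s) →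
             ∃ λ ε → 0# < ε × ∀ s → t ≤ s → s ≤ t + ε → P s
      step t 0≤t t≤1 before =
        extend (local-identity analytic (γ∈D 0≤t t≤1) (acc-at 0≤t t≤1 before))

-- Real powers, rational approximation and the Liouville property.

module Approximation (em : ExcludedMiddle 0ℓ) (ℝ : CompleteOrderedField) where

  open OrderedField em ℝ
  open PowerSeries em ℝ

  module _ {b : Carrier} (1≤b : 1# ≤ b) (t : Setoid.Carrier ℝ⁺) (j : ℕ) (t≤j : proj₁ t ≤ fromℕ j) where

    private
      S : Pred Carrier 0ℓ
      S z = 0# ≤ z × ∃ λ k → ∃ λ l → ℕ.NonZero l × fromℕ k ≤ fromℕ l * proj₁ t × z ^ l ≈ b ^ k

      -- From `k / l ≤ t ≤ j` follows `k ≤ j l`, so the comparison can be made between `l`-th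
      -- powers.
      b^j-upper : UpperBound _≤_ S (b ^ j)
      b^j-upper z (0≤z , k , l , l≢0 , k≤lt , z^l≈b^k) = ^-cancelˡ-≤ l {{l≢0}} (^-nonneg j (≤-trans 0≤1 1≤b)) (begin
        z ^ l           ≈⟨ z^l≈b^k ⟩
        b ^ k           ≤⟨ ^-monoʳ-≤ {m = k} 1≤b (fromℕ-cancel-≤ {k} {j ℕ.* l} (begin
                             fromℕ k             ≤⟨ k≤lt ⟩
                             fromℕ l * proj₁ t   ≤⟨ *-monoʳ-≤ (0≤fromℕ l) t≤j ⟩
                             fromℕ l * fromℕ j   ≈⟨ *-comm _ _ ⟩
                             fromℕ j * fromℕ l   ≈⟨ fromℕ-* j l ⟨
                             fromℕ (j ℕ.* l)     ∎)) ⟩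
        b ^ (j ℕ.* l)   ≈⟨ ^-assocʳ b j l ⟨
        (b ^ j) ^ l     ∎)

      -- The exponent `0 / 1`. Nonemptiness is required before `sup` can be used as a supremum.
      1∈S : S 1#
      1∈S = 0≤1 , 0 , 1 , _ , *-nonneg (0≤fromℕ 1) (proj₁ (proj₂ t)) , *-identityʳ 1#

      S-sup : IsSupremum _≤_ S (b ^ᴿ t)
      S-sup = isSupremum S (1# , 1∈S) (b ^ j , b^j-upper)

    ^ᴿ≤^ : b ^ᴿ t ≤ b ^ j
    ^ᴿ≤^ = proj₂ S-sup (b ^ j) b^j-upper

    1≤^ᴿ : 1# ≤ b ^ᴿ t
    1≤^ᴿ = proj₁ S-sup 1# 1∈S

  ∣fromℤ∣<1⇒≈0 : ∀ i → ∣ fromℤ i ∣ < 1# → fromℤ i ≈ 0#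
  ∣fromℤ∣<1⇒≈0 (+ zero)  small = refl
  ∣fromℤ∣<1⇒≈0 (+ suc n) small = ⊥-elim (<⇒≱ small (≤-trans (1≤fromℕ-suc n) (x≤∣x∣ _)))
  ∣fromℤ∣<1⇒≈0 -[1+ n ]  small = ⊥-elim (<⇒≱ small
    (≤-trans (1≤fromℕ-suc n) (≤-respˡ-≈ (-‿involutive _) (-x≤∣x∣ _))))

  0<denominator : ∀ r → 0# < fromℕ (↧ₙ r)
  0<denominator r = 0<fromℕ-suc (ℚ.denominator-1 r)

  1≤denominator : ∀ r → 1# ≤ fromℕ (↧ₙ r)
  1≤denominator r = 1≤fromℕ-suc (ℚ.denominator-1 r)

  fromℚ*denominator : ∀ r → fromℚ r * fromℕ (↧ₙ r) ≈ fromℤ (↥ r)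
  fromℚ*denominator r = begin-equality
    fromℤ (↥ r) * fromℕ (↧ₙ r) ⁻¹ * fromℕ (↧ₙ r)     ≈⟨ *-assoc _ _ _ ⟩
    fromℤ (↥ r) * (fromℕ (↧ₙ r) ⁻¹ * fromℕ (↧ₙ r))   ≈⟨ *-congˡ (⁻¹-inverseˡ (>⇒≉ (0<denominator r))) ⟩
    fromℤ (↥ r) * 1#                                 ≈⟨ *-identityʳ _ ⟩
    fromℤ (↥ r)                                      ∎

  -- Multiplied by both denominators, the difference becomes an integer of absolute value below 1.
  close-rationals-equal : ∀ r w → ∣ fromℚ r - fromℚ w ∣ * fromℕ (↧ₙ w) < fromℕ (↧ₙ r) ⁻¹ → fromℚ r ≈ fromℚ w
  close-rationals-equal r w close = x-y≈0⇒x≈y (∣x∣≤0⇒x≈0 (*-cancelˡ-≤ (*-pos (0<denominator r) (0<denominator w)) (begin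
    q * q′ * ∣ x ∣       ≈⟨ scaled ⟨
    ∣ fromℤ i ∣          ≈⟨ ∣∣-cong (∣fromℤ∣<1⇒≈0 i i-small) ⟩
    ∣ 0# ∣               ≈⟨ 0≤x⇒∣x∣≈x ≤-refl ⟩
    0#                   ≈⟨ zeroʳ _ ⟨
    q * q′ * 0#          ∎)))
    where
    q q′ x : Carrier
    q  = fromℕ (↧ₙ r)
    q′ = fromℕ (↧ₙ w)
    x  = fromℚ r - fromℚ w

    i : ℤ
    i = ↥ r ℤ.* ↧ w ℤ.- ↥ w ℤ.* ↧ r

    i≈ : fromℤ i ≈ q * q′ * x
    i≈ = begin-equality
      fromℤ i                                            ≈⟨ fromℤ-+ (↥ r ℤ.* ↧ w) _ ⟩
      fromℤ (↥ r ℤ.* ↧ w) + fromℤ (ℤ.- (↥ w ℤ.* ↧ r))    ≈⟨ +-congˡ (fromℤ-neg (↥ w ℤ.* ↧ r)) ⟩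
      fromℤ (↥ r ℤ.* ↧ w) - fromℤ (↥ w ℤ.* ↧ r)          ≈⟨ +-cong (fromℤ-* (↥ r) (↧ w)) (-‿cong (fromℤ-* (↥ w) (↧ r))) ⟩
      fromℤ (↥ r) * q′ - fromℤ (↥ w) * q                 ≈⟨ +-cong (*-congʳ (fromℚ*denominator r))
                                                                   (-‿cong (*-congʳ (fromℚ*denominator w))) ⟨
      fromℚ r * q * q′ - fromℚ w * q′ * q                ≈⟨ solve 4 (λ a b c d → a :* c :* d :- b :* d :* c
                                                              := c :* d :* (a :- b)) refl _ _ q q′ ⟩
      q * q′ * x                                         ∎

    scaled : ∣ fromℤ i ∣ ≈ q * q′ * ∣ x ∣
    scaled = trans (∣∣-cong i≈) (trans (∣xy∣≈∣x∣∣y∣ (q * q′) x)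
      (*-congʳ (0≤x⇒∣x∣≈x (*-nonneg (0≤fromℕ (↧ₙ r)) (0≤fromℕ (↧ₙ w))))))

    i-small : ∣ fromℤ i ∣ < 1#
    i-small = begin-strict
      ∣ fromℤ i ∣          ≈⟨ scaled ⟩
      q * q′ * ∣ x ∣       ≈⟨ solve 3 (λ a b c → a :* b :* c := a :* (c :* b)) refl q q′ ∣ x ∣ ⟩
      q * (∣ x ∣ * q′)     <⟨ *-monoʳ-< (0<denominator r) close ⟩
      q * q ⁻¹             ≈⟨ ⁻¹-inverseʳ (>⇒≉ (0<denominator r)) ⟩
      1#                   ∎

  <-from-multiples : ∀ {X y C ε} → 0# ≤ X → y * X ≤ C → C < X * ε → y < ε
  <-from-multiples {X} {y} 0≤X yX≤C C<Xε =
    *-cancelˡ-< 0≤X (≤-<-trans (≤-respˡ-≈ (*-comm y X) yX≤C) C<Xε)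

  module _ {D : Pred Carrier 0ℓ} (f : Func (Subsetoid D) setoid) where

    open AnalyticFunction f

    GoodApproximation : Func ℝ⁺ ℝ⁺ → Carrier → (m : ℕ) .{{_ : ℕ.NonZero m}} → Set
    GoodApproximation ψ ζ m =
      ∃ λ (r : ℚ) → (+ 2 ℤ.≤ ↥ r) × (2 ℕ.≤ ↧ₙ r) ×
        (∣ ζ - fromℚ r ∣ ≤ (fromℕ (↧ₙ r) ^ m) ⁻¹) ×
        (∃ λ (r∈D : D (fromℚ r)) → ∃ λ (r′ : ℚ) →
          (f[ r∈D ] ≈ fromℚ r′) ×
          (fromℕ (↧ₙ r′) ≤ fromℕ (↧ₙ r) ^ᴿ Func.to ψ (fromℕ⁺ m)))

    -- One scale `X` measures both the distance to `ζ` and the denominator of the value, so the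
    -- later estimates can forget `q` and `j`. The bound `R` is left free, to be chosen from the
    -- Lipschitz data.
    record Approximant (ζ : Carrier) (n : ℕ) (R : Carrier) : Set where
      field
        r r′  : ℚ
        X     : Carrier
        r∈D   : D (fromℚ r)
        fr≈r′ : f[ r∈D ] ≈ fromℚ r′
        R<X   : R < X
        1≤X   : 1# ≤ X
        close : ∣ fromℚ r - ζ ∣ * (X * X ^ n) ≤ 1#
        ↧r′≤X : fromℕ (↧ₙ r′) ≤ X

    -- The exponent enters through its predecessor, so that `m` computes to a successor and is
    -- visibly nonzero.
    rescale : ∀ {ψ ζ n R} j → R < fromℕ (suc j) → let m = suc j ℕ.* suc n in
      proj₁ (Func.to ψ (fromℕ⁺ m)) ≤ fromℕ (suc j) → GoodApproximation ψ ζ m → Approximant ζ n R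
    rescale {ψ} {ζ} {n} {R} j R<1+j ψm≤1+j (r , _ , 2≤q , ∣ζ-r∣≤ , r∈D , r′ , fr≈r′ , ↧r′≤) = record
      { r = r ; r′ = r′ ; X = X ; r∈D = r∈D ; fr≈r′ = fr≈r′
      ; R<X   = <-≤-trans R<1+j (n≤b^n (suc j) (fromℕ-mono-≤ 2≤q))
      ; 1≤X   = 1≤^ (suc j) (1≤denominator r)
      ; close = begin
          ∣ fromℚ r - ζ ∣ * (X ^ suc n)   ≈⟨ *-cong (∣x-y∣≈∣y-x∣ _ _) (^-assocʳ q (suc j) (suc n)) ⟩
          ∣ ζ - fromℚ r ∣ * q ^ m         ≤⟨ x≤y⁻¹⇒x*y≤1 (^-pos m (0<denominator r)) ∣ζ-r∣≤ ⟩
          1#                              ∎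
      ; ↧r′≤X = ≤-trans ↧r′≤ (^ᴿ≤^ (1≤denominator r) (Func.to ψ (fromℕ⁺ m)) (suc j) ψm≤1+j)
      }
      where
      m : ℕ
      m = suc j ℕ.* suc n
      q X : Carrier
      q = fromℕ (↧ₙ r)
      X = q ^ suc j

    -- With m = j (n + 1) and ψ(m) ≤ m / (n + 1) = j, the scale is X = q_m ^ j.
    approximant : ∀ {ψ ζ} → Sublinear ψ → (∀ m .{{_ : ℕ.NonZero m}} → GoodApproximation ψ ζ m) →
                  ∀ n R → Approximant ζ n R
    approximant {ψ} sublinear good n R =
      let M , ψ≤ = sublinear (N ⁻¹) (⁻¹-pos 0<N)
          j₁ , M<j₁ = archimedean M
          j₂ , R<j₂ = archimedean R
          -- Large for two reasons: `m ≥ j₁ > M` brings the bound on `ψ` into force, and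
          -- `j ≥ j₂ > R` makes `q ^ j` exceed `R`.
          j = suc (j₁ ℕ.+ j₂)
          m = j ℕ.* suc n
          j₁≤m = ℕ.≤-trans (ℕ.≤-trans (ℕ.m≤m+n j₁ j₂) (ℕ.n≤1+n _)) (ℕ.m≤m*n j (suc n))
      in rescale {ψ} (j₁ ℕ.+ j₂)
        (<-≤-trans R<j₂ (fromℕ-mono-≤ (ℕ.≤-trans (ℕ.m≤n+m j₂ j₁) (ℕ.n≤1+n _))))
        (begin
          proj₁ (Func.to ψ (fromℕ⁺ m))  ≤⟨ ψ≤ (fromℕ⁺ m) (<-≤-trans M<j₁ (fromℕ-mono-≤ j₁≤m)) ⟩
          N ⁻¹ * fromℕ m                ≈⟨ *-congˡ (trans (fromℕ-* j (suc n)) (*-comm (fromℕ j) N)) ⟩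
          N ⁻¹ * (N * fromℕ j)          ≈⟨ *-cancel⁻¹ (fromℕ j) (>⇒≉ 0<N) ⟩
          fromℕ j                       ∎)
        (good m)
      where
      N : Carrier
      N = fromℕ (suc n)
      0<N : 0# < N
      0<N = 0<fromℕ-suc n

    module _ {ζ : Carrier} {n : ℕ} {R : Carrier} (A : Approximant ζ n R) where
      open Approximant A

      0<X : 0# < X
      0<X = <-≤-trans 0<1 1≤X

      ∣r-ζ∣*X≤1 : ∣ fromℚ r - ζ ∣ * X ≤ 1#
      ∣r-ζ∣*X≤1 = begin
        ∣ fromℚ r - ζ ∣ * X             ≈⟨ *-congˡ (*-identityʳ X) ⟨
        ∣ fromℚ r - ζ ∣ * (X * 1#)      ≤⟨ *-monoʳ-≤ (0≤∣x∣ _) (*-monoʳ-≤ (proj₁ 0<X) (1≤^ n 1≤X)) ⟩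
        ∣ fromℚ r - ζ ∣ * (X * X ^ n)   ≤⟨ close ⟩
        1#                              ∎

      -- The factor `X ^ n` in `close` dominates the power of the denominator; the remaining `X`
      -- stays on the left and later makes the error small.
      value-close : ∀ {K} (ζ∈D : D ζ) → 0# ≤ K →
        ∣ f[ r∈D ] - f[ ζ∈D ] ∣ ≤ ∣ fromℚ r - ζ ∣ * K →
        ∣ f[ ζ∈D ] - fromℚ r′ ∣ * fromℕ (↧ₙ r′) ^ n * X ≤ K
      value-close {K} ζ∈D 0≤K lipschitz = begin
        ∣ f[ ζ∈D ] - fromℚ r′ ∣ * fromℕ (↧ₙ r′) ^ n * X
          ≤⟨ *-monoˡ-≤ (proj₁ 0<X) (*-mono-≤ (*-nonneg (0≤∣x∣ _) 0≤K) (^-nonneg n (0≤fromℕ (↧ₙ r′)))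
               (≤-respˡ-≈ (trans (∣x-y∣≈∣y-x∣ _ _) (∣∣-cong (+-congˡ (-‿cong fr≈r′)))) lipschitz)
               (^-monoˡ-≤ n (0≤fromℕ (↧ₙ r′)) ↧r′≤X)) ⟩
        ∣ fromℚ r - ζ ∣ * K * X ^ n * X
          ≈⟨ solve 4 (λ a k y x → a :* k :* y :* x := k :* (a :* (x :* y))) refl _ K (X ^ n) X ⟩
        K * (∣ fromℚ r - ζ ∣ * (X * X ^ n))    ≤⟨ *-monoʳ-≤ 0≤K close ⟩
        K * 1#                                 ≈⟨ *-identityʳ K ⟩
        K                                      ∎

    -- The origin of the values given to `R`: the numerator `1# + K` makes `X * δ` exceed both `1#`,
    -- for the distance to `ζ`, and `K`, for the error of the value.
    bound-by-X : ∀ {δ K X} → 0# < δ → (1# + K) * δ ⁻¹ < X → 1# + K < X * δ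
    bound-by-X {δ} {K} {X} 0<δ lt = begin-strict
      1# + K                   ≈⟨ *-cancel⁻¹ (1# + K) (>⇒≉ 0<δ) ⟨
      δ ⁻¹ * (δ * (1# + K))    ≈⟨ solve 3 (λ i d k → i :* (d :* k) := d :* (k :* i)) refl (δ ⁻¹) δ (1# + K) ⟩
      δ * ((1# + K) * δ ⁻¹)    <⟨ *-monoʳ-< 0<δ lt ⟩
      δ * X                    ≈⟨ *-comm δ X ⟩
      X * δ                    ∎

    module _ (analytic : RealAnalytic f) {ψ} (sublinear : Sublinear ψ) {ζ} (ζ∈D : D ζ)
             (irrational : Irrational ζ) (good : ∀ m .{{_ : ℕ.NonZero m}} → GoodApproximation ψ ζ m) where

      -- The Lipschitz estimate at `ζ` depends on this, so it uses only the distance to `ζ`: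
      -- exponent `n = 0`, and `0#` in place of the Lipschitz constant.
      rationals-accumulate : AccumulatesAt ζ
      rationals-accumulate δ 0<δ = fromℚ r , r∈D , (λ r≈ζ → irrational (r , sym r≈ζ)) ,
        <-from-multiples (proj₁ (0<X A)) (∣r-ζ∣*X≤1 A)
          (<-respˡ-≈ (+-identityʳ 1#) (bound-by-X 0<δ R<X))
        where
        A : Approximant ζ 0 ((1# + 0#) * δ ⁻¹)
        A = approximant {ψ} sublinear good 0 _
        open Approximant A

      record GoodValue (n : ℕ) (ε : Carrier) : Set where
        field
          r r′   : ℚ
          r∈D    : D (fromℚ r)
          fr≈r′  : f[ r∈D ] ≈ fromℚ r′
          near   : ∣ fromℚ r - ζ ∣ < ε
          close  : ∣ f[ ζ∈D ] - fromℚ r′ ∣ * fromℕ (↧ₙ r′) ^ n < ε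

      Approximant⇒GoodValue : ∀ {K δ n ε} → 0# ≤ K → 0# < δ → δ ≤ ε →
        (∀ {x} (x∈D : D x) → ∣ x - ζ ∣ < δ → ∣ f[ x∈D ] - f[ ζ∈D ] ∣ ≤ ∣ x - ζ ∣ * K) →
        Approximant ζ n ((1# + K) * δ ⁻¹) → GoodValue n ε
      Approximant⇒GoodValue {K} {δ} 0≤K 0<δ δ≤ε lipschitz A = record
        { r     = r
        ; r′    = r′
        ; r∈D   = r∈D
        ; fr≈r′ = fr≈r′
        ; near  = <-≤-trans near δ≤ε
        ; close = <-≤-trans (<-from-multiples (proj₁ (0<X A))
            (value-close A ζ∈D 0≤K (lipschitz r∈D near))
            (≤-<-trans (≤-respˡ-≈ (+-identityˡ K) (+-monoˡ-≤ K 0≤1)) 1+K<Xδ)) δ≤ε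
        }
        where
        open Approximant A
        1+K<Xδ : 1# + K < X * δ
        1+K<Xδ = bound-by-X 0<δ R<X
        near : ∣ fromℚ r - ζ ∣ < δ
        near = <-from-multiples (proj₁ (0<X A)) (∣r-ζ∣*X≤1 A)
          (≤-<-trans (≤-respˡ-≈ (+-identityʳ 1#) (+-monoʳ-≤ 1# 0≤K)) 1+K<Xδ)

      goodValue-from-Lipschitz : LipschitzAt ζ∈D → ∀ n {ε} → 0# < ε → GoodValue n ε
      goodValue-from-Lipschitz (K , δ , 0≤K , 0<δ , lipschitz) n 0<ε =
        let η , 0<η , η≤δ , η≤ε = smaller 0<δ 0<ε in
        Approximant⇒GoodValue 0≤K 0<η η≤ε (λ x∈D near → lipschitz x∈D (<-≤-trans near η≤δ))
          (approximant {ψ} sublinear good n ((1# + K) * η ⁻¹))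

      goodValue : ∀ n {ε} → 0# < ε → GoodValue n ε
      goodValue = goodValue-from-Lipschitz (analytic⇒LipschitzAt analytic ζ∈D rationals-accumulate)

      rational-value-accumulates : ∀ w → f[ ζ∈D ] ≈ fromℚ w → ValueAccumulatesAt (fromℚ w) ζ
      rational-value-accumulates w fζ≈w δ 0<δ =
        -- The threshold involves the fixed denominator of `w`; the varying one of `r′` is the
        -- factor supplied by exponent `n = 1`.
        let ε , 0<ε , ε≤δ , ε≤q⁻¹ = smaller 0<δ (⁻¹-pos (0<denominator w)) in
        point ε≤δ ε≤q⁻¹ (goodValue 1 0<ε)
        where
        point : ∀ {ε} → ε ≤ δ → ε ≤ fromℕ (↧ₙ w) ⁻¹ → GoodValue 1 ε →
                ∃ λ x → ∃ λ (x∈D : D x) → ¬ x ≈ ζ × ∣ x - ζ ∣ < δ × f[ x∈D ] ≈ fromℚ w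
        point ε≤δ ε≤q⁻¹ G = fromℚ r , r∈D , (λ r≈ζ → irrational (r , sym r≈ζ)) , <-≤-trans near ε≤δ ,
          trans fr≈r′ (sym (close-rationals-equal w r′ (<-≤-trans
            (<-respˡ-≈ (*-cong (∣∣-cong (+-congʳ fζ≈w)) (*-identityʳ _)) close) ε≤q⁻¹)))
          where open GoodValue G

      value-irrational : Convex D → ¬ Constant f → Irrational f[ ζ∈D ]
      value-irrational convex ¬constant (w , fζ≈w) = ¬constant
        (fromℚ w , λ x x∈D → identity-theorem analytic convex ζ∈D (rational-value-accumulates w fζ≈w) x∈D)

      value-Liouville : Convex D → ¬ Constant f → Liouville f[ ζ∈D ]
      value-Liouville convex ¬constant = fζ-irrational , approximations
        where
        fζ : Carrier
        fζ = f[ ζ∈D ]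

        fζ-irrational : Irrational fζ
        fζ-irrational = value-irrational convex ¬constant

        -- Irrationality makes every distance positive. The cap at `1#` lets the same `ε` also serve
        -- as the error bound in the Liouville inequality.
        separation : ∀ rs → ∃ λ ε → 0# < ε × ε ≤ 1# × ∀ {r} → r ∈ rs → ε ≤ ∣ fζ - fromℚ r ∣
        separation []       = 1# , 0<1 , ≤-refl , λ ()
        separation (r ∷ rs) =
          let ε₁ , 0<ε₁ , ε₁≤1 , ε₁≤ = separation rs
              ε , 0<ε , ε≤ε₁ , ε≤ = smaller 0<ε₁ (x≉y⇒0<∣x-y∣ λ fζ≈r → fζ-irrational (r , fζ≈r))
          in ε , 0<ε , ≤-trans ε≤ε₁ ε₁≤1 , λ where
            (here ≡.refl)  → ε≤
            (there r′∈rs)  → ≤-trans ε≤ε₁ (ε₁≤ r′∈rs)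

        approximations : ∀ η → Infinite λ r → ∣ fζ - fromℚ r ∣ ≤ (fromℕ (↧ₙ r) ^ᴿ η) ⁻¹
        approximations η rs =
          let n , η<n = archimedean (proj₁ η)
              ε , 0<ε , ε≤1 , ε≤ = separation rs
          in solution (proj₁ η<n) ε≤1 ε≤ (goodValue n 0<ε)
          where
          solution : ∀ {n ε} → proj₁ η ≤ fromℕ n → ε ≤ 1# → (∀ {r} → r ∈ rs → ε ≤ ∣ fζ - fromℚ r ∣) →
                     GoodValue n ε → ∃ λ r → r ∉ rs × ∣ fζ - fromℚ r ∣ ≤ (fromℕ (↧ₙ r) ^ᴿ η) ⁻¹
          solution {n} {ε} η≤n ε≤1 ε≤ G = r′ , r′∉rs ,
            x*y≤1⇒x≤y⁻¹ (<-≤-trans 0<1 (1≤^ᴿ 1≤q η n η≤n)) (begin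
              e * q ^ᴿ η  ≤⟨ *-monoʳ-≤ (0≤∣x∣ _) (^ᴿ≤^ 1≤q η n η≤n) ⟩
              e * q ^ n   ≤⟨ proj₁ close ⟩
              ε           ≤⟨ ε≤1 ⟩
              1#          ∎)
            where
            open GoodValue G
            q e : Carrier
            q = fromℕ (↧ₙ r′)
            e = ∣ fζ - fromℚ r′ ∣
            1≤q : 1# ≤ q
            1≤q = 1≤denominator r′
            r′∉rs : r′ ∉ rs
            -- As `q ≥ 1`, the unscaled error `e` is itself below `ε`, too small for a member of the
            -- list.
            r′∉rs r′∈rs = <⇒≱ close (begin
              ε           ≤⟨ ε≤ r′∈rs ⟩
              e           ≈⟨ *-identityʳ e ⟨
              e * 1#      ≤⟨ *-monoʳ-≤ (0≤∣x∣ _) (1≤^ n 1≤q) ⟩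
              e * q ^ n   ∎)

  -- Convexity of open intervals with possibly infinite endpoints.

  between : ∀ {x y t} → 0# ≤ t → t ≤ 1# →
    (x ≤ x + t * (y - x) × x + t * (y - x) ≤ y) ⊎ (y ≤ x + t * (y - x) × x + t * (y - x) ≤ x)
  between {x} {y} {t} 0≤t t≤1 with total x y
  ... | inj₁ x≤y = inj₁
    ( ≤-respˡ-≈ (+-identityʳ x) (+-monoʳ-≤ x (*-nonneg 0≤t (x≤y⇒0≤y-x x≤y)))
    , (begin
        x + t * (y - x)     ≤⟨ +-monoʳ-≤ x (*-monoˡ-≤ (x≤y⇒0≤y-x x≤y) t≤1) ⟩
        x + 1# * (y - x)    ≈⟨ solve 2 (λ x y → x :+ con (+ 1) :* (y :- x) := y) refl x y ⟩
        y                   ∎))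
  ... | inj₂ y≤x = inj₂
    ( (begin
        y                   ≈⟨ solve 2 (λ x y → y := x :- con (+ 1) :* (x :- y)) refl x y ⟩
        x - 1# * (x - y)    ≤⟨ +-monoʳ-≤ x (neg-mono-≤ (*-monoˡ-≤ (x≤y⇒0≤y-x y≤x) t≤1)) ⟩
        x - t * (x - y)     ≈⟨ flip ⟩
        x + t * (y - x)     ∎)
    , (begin
        x + t * (y - x)     ≈⟨ flip ⟨
        x - t * (x - y)     ≤⟨ +-monoʳ-≤ x (-x≤0 (*-nonneg 0≤t (x≤y⇒0≤y-x y≤x))) ⟩
        x + 0#              ≈⟨ +-identityʳ x ⟩
        x                   ∎))
    where
    flip : x - t * (x - y) ≈ x + t * (y - x)
    flip = solve 3 (λ x y t → x :- t :* (x :- y) := x :+ t :* (y :- x)) refl x y t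

  <±-≤-trans : ∀ {a x y} → a <± [ x ] → x ≤ y → a <± [ y ]
  <±-≤-trans Extended.⊥±<[ _ ] x≤y = Extended.⊥±<[ _ ]
  <±-≤-trans Extended.[ a<x ]  x≤y = Extended.[ <-≤-trans a<x x≤y ]

  ≤-<±-trans : ∀ {x y b} → x ≤ y → [ y ] <± b → [ x ] <± b
  ≤-<±-trans x≤y Extended.[ y<b ]   = Extended.[ ≤-<-trans x≤y y<b ]
  ≤-<±-trans x≤y Extended.[ _ ]<⊤±  = Extended.[ _ ]<⊤±

  OpenInterval-convex : ∀ {a b} → Convex (OpenInterval a b)
  OpenInterval-convex (a<x , x<b) (a<y , y<b) 0≤t t≤1 with between 0≤t t≤1
  ... | inj₁ (x≤z , z≤y) = <±-≤-trans a<x x≤z , ≤-<±-trans z≤y y<b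
  ... | inj₂ (y≤z , z≤x) = <±-≤-trans a<y y≤z , ≤-<±-trans z≤x x<b

theorem2p1 : ExcludedMiddle 0ℓ → (ℝ : CompleteOrderedField) →
    let open Reals ℝ in
    ∀ a b (f : Func (Subsetoid (OpenInterval a b)) setoid) →
    RealAnalytic f → ¬ Constant f → PreservesRationals f →
    (∃ λ (ψ : Func ℝ⁺ ℝ⁺) → Sublinear ψ × GoodApproximations f ψ) →
    ∀ ζ (ζ∈I : OpenInterval a b ζ) → Liouville ζ → Liouville (Func.to f (ζ , ζ∈I))
theorem2p1 em ℝ a b f analytic ¬constant _ (ψ , sublinear , good) ζ ζ∈I ζ-Liouville =
  value-Liouville f analytic {ψ} sublinear ζ∈I (proj₁ ζ-Liouville) (good ζ ζ-Liouville ζ∈I)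
    OpenInterval-convex ¬constant
  where open Approximation em ℝ
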